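{- Let $r\ge 1$ be an integer and let $Z(r)$ be the Young–Fibonacci $r$-differential poset. Write $p_n$ for the number of elements of rank $n$ in $Z(r)$, with $p_k:=0$ for $k<0$, and $\Delta p_n:=p_n-p_{n-1}$. Then: (1) for every $n\ge 0$, the matrix $DU_n+tI$ in $\mathbb{Z}[t]^{p_n\times p_n}$ has a Smith form over $\mathbb{Z}[t]$; (2) for every $n\ge 1$ and every $1\le j\le n$ one has $\Delta p_n\ge \Delta p_{n-j-\delta_{r,1}}$ (i.e. $\Delta p_n\ge\Delta p_{n-j-1}$ if $r=1$, and $\Delta p_n\ge \Delta p_{n-j}$ if $r\ge 2$); (3) for every $n\ge 0$, the cokernel of $U_n:\mathbb{Z}^{p_n}\to\mathbb{Z}^{p_{n+1}}$ is a free abelian group.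
   Context: $Z(r)$ is the set of all finite words in the alphabet $\{1_1,1_2,\dots,1_r,2\}$; the rank of a word is the sum of its letters, where each $1_i$ has value $1$ and $2$ has value $2$ (the empty word is the minimum, of rank $0$). A word $w$ covers a word $w'$ if either (a) $w'$ is obtained from $w$ by changing a letter $2$ into some $1_i$, provided only letters $2$ occur to the left of it, or (b) $w'$ is obtained from $w$ by deleting its first (leftmost) letter of the form $1_i$. This is an $r$-differential poset. For a graded poset $P$ with rank sets $P_n$, $p_n=|P_n|$, the up map $U_n:\mathbb{Z}^{P_n}\to\mathbb{Z}^{P_{n+1}}$ sends each basis element $x$ to the sum of all elements covering $x$, and the down map $D_n:\mathbb{Z}^{P_n}\to\mathbb{Z}^{P_{n-1}}$ sends $x$ to the sum of all elements covered by $x$ (so $D_{n+1}=U_n^t$); $DU_n:=D_{n+1}U_n$, viewed as a $p_n\times p_n$ integer matrix in the basis $P_n$. A matrix $B$ over a commutative ring $S$ is in Smith form if it is diagonal (off-diagonal entries zero) with diagonal entries $s_1,s_2,\dots$ such that $s_i$ divides $s_{i+1}$ in $S$ for all $i$; $B$ has a Smith form over $S$ if $PBQ$ is in Smith form for some invertible matrices $P,Q$ over $S$. -}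

module Defs where

open import Algebra.Bundles using (CommutativeRing; AbelianGroup)
open import Algebra.Morphism.Structures using (module GroupMorphisms)
import Algebra.Construct.Pointwise as Pointwise
import Algebra.Properties.Semiring.Divisibility as SemiringDivisibility
import Algebra.Properties.AbelianGroup as AbelianGroupProperties
import Algebra.Properties.CommutativeSemigroup as CommutativeSemigroupProperties
import Algebra.Properties.Ring as RingProperties
import Algebra.Properties.Semiring.Sum as SemiringSum
open import Data.Bool.Base using (if_then_else_)
open import Data.Fin.Base using (Fin; toℕ)
import Data.Fin.Properties as Fin
open import Data.Integer.Base as ℤ using (ℤ; +_; -[1+_]; 0ℤ; 1ℤ)
import Data.Integer.Properties as ℤ
open import Data.Integer.Tactic.RingSolver using (solve-∀)
open import Data.List.Base using (List; []; _∷_; _++_; map; length; lookup; allFin; cartesianProductWith)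
open import Data.List.Membership.Propositional using (_∈_)
open import Data.List.Membership.Propositional.Properties using (∈-++⁺ˡ; ∈-++⁺ʳ; ∈-++⁻; ∈-map⁺; ∈-map⁻; ∈-allFin; ∈-cartesianProductWith⁺; ∈-cartesianProductWith⁻)
open import Data.List.Properties using (≡-dec; ∷-injectiveʳ)
open import Data.List.Relation.Unary.All using (All; []; _∷_)
open import Data.List.Relation.Unary.Any using (here)
open import Data.List.Relation.Unary.Unique.Propositional using (Unique; []; _∷_)
import Data.List.Relation.Unary.Unique.Propositional.Properties as Unique
open import Data.Nat.Base as ℕ using (ℕ; zero; suc)
import Data.Nat.Properties as ℕ
open import Data.Product using (Σ; ∃-syntax; _×_; _,_)
open import Data.Sum using (inj₁; inj₂)
open import Data.Vec.Functional using (Vector)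
open import Level using (Level; _⊔_; 0ℓ)
open import Relation.Binary.Definitions using (DecidableEquality)
open import Relation.Binary.PropositionalEquality using (_≡_; _≢_; refl; sym; trans; cong; cong₂; module ≡-Reasoning)
open import Relation.Nullary using (Dec; yes; no; does; ¬_)
open import Relation.Nullary.Decidable using (map′)

private variable
  c ℓ c′ ℓ′ : Level

------------------------------------------------------------------------
-- The Young–Fibonacci poset Z(r)

data Letter (r : ℕ) : Set where
  𝟏 : Fin r → Letter r
  𝟐 : Letter r

Word : ℕ → Set
Word r = List (Letter r)

value : ∀ {r} → Letter r → ℕ
value (𝟏 _) = 1
value 𝟐     = 2

rank : ∀ {r} → Word r → ℕ
rank []      = 0
rank (x ∷ w) = value x ℕ.+ rank w

infix 4 _⋖_ _⋖?_

-- w′ ⋖ w : the word w covers the word w′.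
data _⋖_ {r : ℕ} : Word r → Word r → Set where
  change : ∀ {u} i v → All (_≡ 𝟐) u → u ++ 𝟏 i ∷ v ⋖ u ++ 𝟐 ∷ v
  delete : ∀ {u} i v → All (_≡ 𝟐) u → u ++ v ⋖ u ++ 𝟏 i ∷ v

private
  𝟐∷⁺ : ∀ {r} {w′ w : Word r} → w′ ⋖ w → 𝟐 ∷ w′ ⋖ 𝟐 ∷ w
  𝟐∷⁺ (change i v us) = change i v (refl ∷ us)
  𝟐∷⁺ (delete i v us) = delete i v (refl ∷ us)

  data Covers {r : ℕ} : Word r → Word r → Set where
    changeHead : ∀ i v → Covers (𝟏 i ∷ v) (𝟐 ∷ v)
    deleteHead : ∀ i v → Covers v (𝟏 i ∷ v)
    below𝟐     : ∀ {w′ w} → w′ ⋖ w → Covers (𝟐 ∷ w′) (𝟐 ∷ w)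

  covers : ∀ {r} {w′ w : Word r} → w′ ⋖ w → Covers w′ w
  covers (change i v [])          = changeHead i v
  covers (change i v (refl ∷ us)) = below𝟐 (change i v us)
  covers (delete i v [])          = deleteHead i v
  covers (delete i v (refl ∷ us)) = below𝟐 (delete i v us)

  uncovers : ∀ {r} {w′ w : Word r} → Covers w′ w → w′ ⋖ w
  uncovers (changeHead i v) = change i v []
  uncovers (deleteHead i v) = delete i v []
  uncovers (below𝟐 c)       = 𝟐∷⁺ c

infix 4 _≟ˡ_

_≟ˡ_ : ∀ {r} → DecidableEquality (Letter r)
𝟏 i ≟ˡ 𝟏 j = map′ (cong 𝟏) (λ { refl → refl }) (i Fin.≟ j)
𝟏 _ ≟ˡ 𝟐   = no λ ()
𝟐   ≟ˡ 𝟏 _ = no λ ()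
𝟐   ≟ˡ 𝟐   = yes refl

_⋖?_ : ∀ {r} (w′ w : Word r) → Dec (w′ ⋖ w)
w′ ⋖? w = map′ uncovers covers (covers? w′ w)
  where
  covers? : ∀ {r} (w′ w : Word r) → Dec (Covers w′ w)
  covers? w′ []              = no λ ()
  covers? w′ (𝟏 i ∷ w)       = map′ (λ { refl → deleteHead i w }) (λ { (deleteHead _ _) → refl }) (≡-dec _≟ˡ_ w′ w)
  covers? [] (𝟐 ∷ w)         = no λ ()
  covers? (𝟏 i ∷ w′) (𝟐 ∷ w) = map′ (λ { refl → changeHead i w }) (λ { (changeHead _ _) → refl }) (≡-dec _≟ˡ_ w′ w)
  covers? (𝟐 ∷ w′) (𝟐 ∷ w)   = map′ (λ c → below𝟐 (uncovers c)) (λ { (below𝟐 c) → covers c }) (covers? w′ w)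

-- words r n lists each word of rank n exactly once, by words-sound,
-- words-complete and words-unique.
words : ∀ r → ℕ → List (Word r)
words r zero          = [] ∷ []
words r (suc zero)    = cartesianProductWith (λ i w → 𝟏 i ∷ w) (allFin r) (words r zero)
words r (suc (suc n)) = cartesianProductWith (λ i w → 𝟏 i ∷ w) (allFin r) (words r (suc n))
                     ++ map (𝟐 ∷_) (words r n)

words-sound : ∀ r n {w} → w ∈ words r n → rank w ≡ n
words-sound r zero (here refl) = refl
words-sound r (suc zero) w∈
  with _ , _ , _ , v∈ , refl ← ∈-cartesianProductWith⁻ _ (allFin r) (words r zero) w∈
  = cong suc (words-sound r zero v∈)
words-sound r (suc (suc n)) w∈
  with ∈-++⁻ (cartesianProductWith _ (allFin r) (words r (suc n))) w∈
... | inj₁ w∈₁ with _ , _ , _ , v∈ , refl ← ∈-cartesianProductWith⁻ _ (allFin r) (words r (suc n)) w∈₁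
  = cong suc (words-sound r (suc n) v∈)
... | inj₂ w∈₂ with _ , v∈ , refl ← ∈-map⁻ (𝟐 ∷_) w∈₂
  = cong (2 ℕ.+_) (words-sound r n v∈)

words-complete : ∀ r (w : Word r) → w ∈ words r (rank w)
words-complete r [] = here refl
words-complete r (𝟏 i ∷ w) = step (rank w) (words-complete r w)
  where
  step : ∀ n → w ∈ words r n → 𝟏 i ∷ w ∈ words r (suc n)
  step zero    w∈ = ∈-cartesianProductWith⁺ (λ i w → 𝟏 i ∷ w) (∈-allFin i) w∈
  step (suc n) w∈ = ∈-++⁺ˡ (∈-cartesianProductWith⁺ (λ i w → 𝟏 i ∷ w) (∈-allFin i) w∈)
words-complete r (𝟐 ∷ w) = ∈-++⁺ʳ _ (∈-map⁺ (𝟐 ∷_) (words-complete r w))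

words-unique : ∀ r n → Unique (words r n)
words-unique r zero          = [] ∷ []
words-unique r (suc zero)    = Unique.cartesianProductWith⁺ _ (λ { refl → refl , refl }) (Unique.allFin⁺ r) (words-unique r zero)
words-unique r (suc (suc n)) = Unique.++⁺
  (Unique.cartesianProductWith⁺ _ (λ { refl → refl , refl }) (Unique.allFin⁺ r) (words-unique r (suc n)))
  (Unique.map⁺ ∷-injectiveʳ (words-unique r n))
  disjoint
  where
  disjoint : ∀ {w} → ¬ (w ∈ cartesianProductWith (λ i w → 𝟏 i ∷ w) (allFin r) (words r (suc n))
                        × w ∈ map (𝟐 ∷_) (words r n))
  disjoint (w∈₁ , w∈₂)
    with _ , _ , _ , _ , refl ← ∈-cartesianProductWith⁻ _ (allFin r) (words r (suc n)) w∈₁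
    with _ , _ , () ← ∈-map⁻ (𝟐 ∷_) w∈₂

p : ℕ → ℕ → ℕ
p r n = length (words r n)

-- The basis of ℤ^{P_n}.
word : ∀ r n → Fin (p r n) → Word r
word r n = lookup (words r n)

pℤ : ℕ → ℤ → ℤ
pℤ r (+ n)    = + p r n
pℤ r -[1+ _ ] = 0ℤ

Δp : ℕ → ℤ → ℤ
Δp r k = pℤ r k ℤ.- pℤ r (k ℤ.- 1ℤ)

-- Kronecker delta
δ : ℕ → ℕ → ℤ
δ i j = if does (i ℕ.≟ j) then 1ℤ else 0ℤ

------------------------------------------------------------------------
-- Matrices over a commutative ring and their Smith forms

module Matrices (S : CommutativeRing c ℓ) where

  open CommutativeRing S
  open SemiringSum semiring using (sum; sum-cong-≋; ∑-distrib-+; *-distribˡ-sum)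
  open SemiringDivisibility semiring using (_∣_)

  Matrix : ℕ → ℕ → Set c
  Matrix m n = Fin m → Fin n → Carrier

  infix  4 _≈ᴹ_
  infixl 6 _+ᴹ_
  infixl 7 _*ᴹ_ _·ᴹ_ _*ᵛ_

  _≈ᴹ_ : ∀ {m n} → Matrix m n → Matrix m n → Set ℓ
  A ≈ᴹ B = ∀ i j → A i j ≈ B i j

  _+ᴹ_ : ∀ {m n} → Matrix m n → Matrix m n → Matrix m n
  (A +ᴹ B) i j = A i j + B i j

  _*ᴹ_ : ∀ {l m n} → Matrix l m → Matrix m n → Matrix l n
  (A *ᴹ B) i k = sum (λ j → A i j * B j k)

  _·ᴹ_ : ∀ {m n} → Carrier → Matrix m n → Matrix m n
  (a ·ᴹ A) i j = a * A i j

  1ᴹ : ∀ {n} → Matrix n n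
  1ᴹ i j = if does (i Fin.≟ j) then 1# else 0#

  _*ᵛ_ : ∀ {m n} → Matrix m n → Vector Carrier n → Vector Carrier m
  (A *ᵛ x) i = sum (λ j → A i j * x j)

  Invertible : ∀ {n} → Matrix n n → Set (c ⊔ ℓ)
  Invertible P = ∃[ P⁻¹ ] (P *ᴹ P⁻¹ ≈ᴹ 1ᴹ) × (P⁻¹ *ᴹ P ≈ᴹ 1ᴹ)

  -- The diagonal entries s of a (possibly rectangular) matrix are the
  -- entries whose row and column have the same number.
  record IsSmithForm {m n} (B : Matrix m n) : Set (c ⊔ ℓ) where
    field
      diagonal : ∀ i j → toℕ i ≢ toℕ j → B i j ≈ 0#
      divides  : ∀ i j i⁺ j⁺ → toℕ i ≡ toℕ j → toℕ i⁺ ≡ suc (toℕ i) → toℕ j⁺ ≡ suc (toℕ j) →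
                 B i j ∣ B i⁺ j⁺

  HasSmithForm : ∀ {m n} → Matrix m n → Set (c ⊔ ℓ)
  HasSmithForm B = ∃[ P ] ∃[ Q ] Invertible P × Invertible Q × IsSmithForm (P *ᴹ B *ᴹ Q)

  -- The additive group of Sⁿ.
  infix 8 S^_

  S^_ : ℕ → AbelianGroup c ℓ
  S^ n = Pointwise.abelianGroup (Fin n) +-abelianGroup

  *ᵛ-isGroupHomomorphism : ∀ {m n} (A : Matrix m n) →
    GroupMorphisms.IsGroupHomomorphism (AbelianGroup.rawGroup (S^ n)) (AbelianGroup.rawGroup (S^ m)) (A *ᵛ_)
  *ᵛ-isGroupHomomorphism {m} {n} A = record
    { isMonoidHomomorphism = record
      { isMagmaHomomorphism = record
        { isRelHomomorphism = record { cong = A*-cong }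
        ; homo = A*-+
        }
      ; ε-homo = A*-0
      }
    ; ⁻¹-homo = λ x i → A*-neg x i
    }
    where
    module ⇒ = CommutativeRing S
    open AbelianGroup (S^ n) using () renaming (_≈_ to _≈ⁿ_; _∙_ to _+ⁿ_; ε to 0ⁿ; _⁻¹ to -ⁿ_)
    open RingProperties ring using (+-inverseʳ-unique)

    A*-cong : ∀ {x y} → x ≈ⁿ y → ∀ i → (A *ᵛ x) i ≈ (A *ᵛ y) i
    A*-cong x≈y i = sum-cong-≋ (λ j → *-congˡ (x≈y j))

    A*-+ : ∀ x y i → (A *ᵛ (x +ⁿ y)) i ≈ (A *ᵛ x) i + (A *ᵛ y) i
    A*-+ x y i = ⇒.trans (sum-cong-≋ (λ j → distribˡ (A i j) (x j) (y j)))
                         (∑-distrib-+ (λ j → A i j * x j) (λ j → A i j * y j))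

    A*-0 : ∀ i → (A *ᵛ 0ⁿ) i ≈ 0#
    A*-0 i = ⇒.trans (sum-cong-≋ (λ j → ⇒.trans (zeroʳ (A i j)) (⇒.sym (zeroˡ 0#))))
             (⇒.trans (⇒.sym (*-distribˡ-sum {n} 0# (λ _ → 0#))) (zeroˡ _))

    A*-neg : ∀ x i → (A *ᵛ (-ⁿ x)) i ≈ - (A *ᵛ x) i
    A*-neg x i = +-inverseʳ-unique _ _
      (⇒.trans (⇒.sym (A*-+ x (-ⁿ x) i)) (⇒.trans (A*-cong (λ j → -‿inverseʳ (x j)) i) (A*-0 i)))

------------------------------------------------------------------------
-- The polynomial ring ℤ[t]

-- Coefficient lists, constant term first, compared up to trailing zeros.
Poly : Set
Poly = List ℤ

coeff : Poly → ℕ → ℤ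
coeff []      _       = 0ℤ
coeff (a ∷ _) zero    = a
coeff (_ ∷ f) (suc k) = coeff f k

infix 4 _≈ₚ_

record _≈ₚ_ (f g : Poly) : Set where
  constructor coeffwise
  field coeff-≡ : ∀ k → coeff f k ≡ coeff g k

open _≈ₚ_ public

infixl 6 _+ₚ_
infixl 7 _*ₚ_ _·ₚ_
infix  8 -ₚ_

_+ₚ_ : Poly → Poly → Poly
[]      +ₚ g       = g
(a ∷ f) +ₚ []      = a ∷ f
(a ∷ f) +ₚ (b ∷ g) = a ℤ.+ b ∷ f +ₚ g

-ₚ_ : Poly → Poly
-ₚ f = map (ℤ.-_) f

_·ₚ_ : ℤ → Poly → Poly
a ·ₚ f = map (a ℤ.*_) f

-- (a + t f) g = a g + t (f g)
_*ₚ_ : Poly → Poly → Poly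
[]      *ₚ g = []
(a ∷ f) *ₚ g = a ·ₚ g +ₚ (0ℤ ∷ f *ₚ g)

const : ℤ → Poly
const a = a ∷ []

t : Poly
t = 0ℤ ∷ 1ℤ ∷ []

coeff-+ : ∀ f g k → coeff (f +ₚ g) k ≡ coeff f k ℤ.+ coeff g k
coeff-+ []      g       k       = sym (ℤ.+-identityˡ _)
coeff-+ (a ∷ f) []      k       = sym (ℤ.+-identityʳ _)
coeff-+ (a ∷ f) (b ∷ g) zero    = refl
coeff-+ (a ∷ f) (b ∷ g) (suc k) = coeff-+ f g k

coeff-neg : ∀ f k → coeff (-ₚ f) k ≡ ℤ.- coeff f k
coeff-neg []      k       = refl
coeff-neg (a ∷ f) zero    = refl
coeff-neg (a ∷ f) (suc k) = coeff-neg f k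

coeff-· : ∀ a f k → coeff (a ·ₚ f) k ≡ a ℤ.* coeff f k
coeff-· a []      k       = sym (ℤ.*-zeroʳ a)
coeff-· a (b ∷ f) zero    = refl
coeff-· a (b ∷ f) (suc k) = coeff-· a f k

coeff-*-zero : ∀ a f g → coeff ((a ∷ f) *ₚ g) 0 ≡ a ℤ.* coeff g 0
coeff-*-zero a f g = trans (coeff-+ (a ·ₚ g) (0ℤ ∷ f *ₚ g) 0)
  (trans (ℤ.+-identityʳ _) (coeff-· a g 0))

coeff-*-suc : ∀ a f g k → coeff ((a ∷ f) *ₚ g) (suc k) ≡ a ℤ.* coeff g (suc k) ℤ.+ coeff (f *ₚ g) k
coeff-*-suc a f g k = trans (coeff-+ (a ·ₚ g) (0ℤ ∷ f *ₚ g) (suc k))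
  (cong (ℤ._+ coeff (f *ₚ g) k) (coeff-· a g (suc k)))

private
  open ≡-Reasoning

  *-zeroʳ : ∀ f k → coeff (f *ₚ []) k ≡ 0ℤ
  *-zeroʳ []      k       = refl
  *-zeroʳ (a ∷ f) zero    = refl
  *-zeroʳ (a ∷ f) (suc k) = *-zeroʳ f k

  *-null : ∀ f g → (∀ k → coeff f k ≡ 0ℤ) → ∀ k → coeff (f *ₚ g) k ≡ 0ℤ
  *-null []      g f≡0 k    = refl
  *-null (a ∷ f) g f≡0 zero = begin
    coeff ((a ∷ f) *ₚ g) 0 ≡⟨ coeff-*-zero a f g ⟩
    a ℤ.* coeff g 0        ≡⟨ cong (ℤ._* coeff g 0) (f≡0 0) ⟩
    0ℤ                     ∎
  *-null (a ∷ f) g f≡0 (suc k) = begin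
    coeff ((a ∷ f) *ₚ g) (suc k)                   ≡⟨ coeff-*-suc a f g k ⟩
    a ℤ.* coeff g (suc k) ℤ.+ coeff (f *ₚ g) k     ≡⟨ cong₂ (λ x y → x ℤ.* coeff g (suc k) ℤ.+ y) (f≡0 0) (*-null f g (λ k → f≡0 (suc k)) k) ⟩
    0ℤ                                             ∎

  *-congʳ : ∀ f f′ g → (∀ k → coeff f k ≡ coeff f′ k) → ∀ k → coeff (f *ₚ g) k ≡ coeff (f′ *ₚ g) k
  *-congʳ []      f′        g eq k       = sym (*-null f′ g (λ k → sym (eq k)) k)
  *-congʳ (a ∷ f) []        g eq k       = *-null (a ∷ f) g eq k
  *-congʳ (a ∷ f) (a′ ∷ f′) g eq zero    = begin
    coeff ((a ∷ f) *ₚ g) 0   ≡⟨ coeff-*-zero a f g ⟩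
    a ℤ.* coeff g 0          ≡⟨ cong (ℤ._* coeff g 0) (eq 0) ⟩
    a′ ℤ.* coeff g 0         ≡⟨ coeff-*-zero a′ f′ g ⟨
    coeff ((a′ ∷ f′) *ₚ g) 0 ∎
  *-congʳ (a ∷ f) (a′ ∷ f′) g eq (suc k) = begin
    coeff ((a ∷ f) *ₚ g) (suc k)                  ≡⟨ coeff-*-suc a f g k ⟩
    a ℤ.* coeff g (suc k) ℤ.+ coeff (f *ₚ g) k    ≡⟨ cong₂ (λ x y → x ℤ.* coeff g (suc k) ℤ.+ y) (eq 0) (*-congʳ f f′ g (λ k → eq (suc k)) k) ⟩
    a′ ℤ.* coeff g (suc k) ℤ.+ coeff (f′ *ₚ g) k  ≡⟨ coeff-*-suc a′ f′ g k ⟨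
    coeff ((a′ ∷ f′) *ₚ g) (suc k)                ∎

  *-cons : ∀ f b g k → coeff (f *ₚ (b ∷ g)) k ≡ coeff ((b ·ₚ f) +ₚ (0ℤ ∷ f *ₚ g)) k
  *-cons []      b g zero    = refl
  *-cons []      b g (suc k) = refl
  *-cons (a ∷ f) b g zero    = cong (ℤ._+ 0ℤ) (ℤ.*-comm a b)
  *-cons (a ∷ f) b g (suc k) = begin
    coeff ((a ∷ f) *ₚ (b ∷ g)) (suc k)
      ≡⟨ coeff-*-suc a f (b ∷ g) k ⟩
    a ℤ.* coeff g k ℤ.+ coeff (f *ₚ (b ∷ g)) k
      ≡⟨ cong (λ x → a ℤ.* coeff g k ℤ.+ x) (trans (*-cons f b g k) (coeff-+ (b ·ₚ f) (0ℤ ∷ f *ₚ g) k)) ⟩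
    a ℤ.* coeff g k ℤ.+ (coeff (b ·ₚ f) k ℤ.+ coeff (0ℤ ∷ f *ₚ g) k)
      ≡⟨ cong (λ x → x ℤ.+ (coeff (b ·ₚ f) k ℤ.+ coeff (0ℤ ∷ f *ₚ g) k)) (coeff-· a g k) ⟨
    coeff (a ·ₚ g) k ℤ.+ (coeff (b ·ₚ f) k ℤ.+ coeff (0ℤ ∷ f *ₚ g) k)
      ≡⟨ exchange (coeff (a ·ₚ g) k) (coeff (b ·ₚ f) k) (coeff (0ℤ ∷ f *ₚ g) k) ⟩
    coeff (b ·ₚ f) k ℤ.+ (coeff (a ·ₚ g) k ℤ.+ coeff (0ℤ ∷ f *ₚ g) k)
      ≡⟨ cong (λ x → coeff (b ·ₚ f) k ℤ.+ x) (coeff-+ (a ·ₚ g) (0ℤ ∷ f *ₚ g) k) ⟨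
    coeff (b ·ₚ f) k ℤ.+ coeff ((a ∷ f) *ₚ g) k
      ≡⟨ coeff-+ (b ·ₚ f) ((a ∷ f) *ₚ g) k ⟨
    coeff (b ·ₚ f +ₚ (a ∷ f) *ₚ g) k ∎
    where
    exchange : ∀ x y z → x ℤ.+ (y ℤ.+ z) ≡ y ℤ.+ (x ℤ.+ z)
    exchange = solve-∀

  shift-cong : ∀ {f g} → (∀ k → coeff f k ≡ coeff g k) → ∀ k → coeff (0ℤ ∷ f) k ≡ coeff (0ℤ ∷ g) k
  shift-cong eq zero    = refl
  shift-cong eq (suc k) = eq k

  +-cong : ∀ f f′ g g′ → (∀ k → coeff f k ≡ coeff f′ k) → (∀ k → coeff g k ≡ coeff g′ k) →
           ∀ k → coeff (f +ₚ g) k ≡ coeff (f′ +ₚ g′) k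
  +-cong f f′ g g′ eq eq′ k = begin
    coeff (f +ₚ g) k             ≡⟨ coeff-+ f g k ⟩
    coeff f k ℤ.+ coeff g k      ≡⟨ cong₂ ℤ._+_ (eq k) (eq′ k) ⟩
    coeff f′ k ℤ.+ coeff g′ k    ≡⟨ coeff-+ f′ g′ k ⟨
    coeff (f′ +ₚ g′) k           ∎

  *-comm : ∀ f g k → coeff (f *ₚ g) k ≡ coeff (g *ₚ f) k
  *-comm []      g k = sym (*-zeroʳ g k)
  *-comm (a ∷ f) g k = begin
    coeff (a ·ₚ g +ₚ (0ℤ ∷ f *ₚ g)) k ≡⟨ +-cong (a ·ₚ g) (a ·ₚ g) (0ℤ ∷ f *ₚ g) (0ℤ ∷ g *ₚ f) (λ _ → refl) (shift-cong (*-comm f g)) k ⟩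
    coeff (a ·ₚ g +ₚ (0ℤ ∷ g *ₚ f)) k ≡⟨ *-cons g a f k ⟨
    coeff (g *ₚ (a ∷ f)) k            ∎

  *-distribʳ : ∀ h f g k → coeff ((f +ₚ g) *ₚ h) k ≡ coeff (f *ₚ h +ₚ g *ₚ h) k
  *-distribʳ h []      g       k       = refl
  *-distribʳ h (a ∷ f) []      k       = sym (trans (coeff-+ ((a ∷ f) *ₚ h) [] k) (ℤ.+-identityʳ _))
  *-distribʳ h (a ∷ f) (b ∷ g) zero    = begin
    coeff ((a ℤ.+ b ∷ f +ₚ g) *ₚ h) 0                    ≡⟨ coeff-*-zero (a ℤ.+ b) (f +ₚ g) h ⟩
    (a ℤ.+ b) ℤ.* coeff h 0                              ≡⟨ ℤ.*-distribʳ-+ (coeff h 0) a b ⟩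
    a ℤ.* coeff h 0 ℤ.+ b ℤ.* coeff h 0                  ≡⟨ cong₂ ℤ._+_ (coeff-*-zero a f h) (coeff-*-zero b g h) ⟨
    coeff ((a ∷ f) *ₚ h) 0 ℤ.+ coeff ((b ∷ g) *ₚ h) 0    ≡⟨ coeff-+ ((a ∷ f) *ₚ h) ((b ∷ g) *ₚ h) 0 ⟨
    coeff ((a ∷ f) *ₚ h +ₚ (b ∷ g) *ₚ h) 0               ∎
  *-distribʳ h (a ∷ f) (b ∷ g) (suc k) = begin
    coeff ((a ℤ.+ b ∷ f +ₚ g) *ₚ h) (suc k)
      ≡⟨ coeff-*-suc (a ℤ.+ b) (f +ₚ g) h k ⟩
    (a ℤ.+ b) ℤ.* coeff h (suc k) ℤ.+ coeff ((f +ₚ g) *ₚ h) k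
      ≡⟨ cong (λ x → (a ℤ.+ b) ℤ.* coeff h (suc k) ℤ.+ x) (trans (*-distribʳ h f g k) (coeff-+ (f *ₚ h) (g *ₚ h) k)) ⟩
    (a ℤ.+ b) ℤ.* coeff h (suc k) ℤ.+ (coeff (f *ₚ h) k ℤ.+ coeff (g *ₚ h) k)
      ≡⟨ regroup a b (coeff h (suc k)) (coeff (f *ₚ h) k) (coeff (g *ₚ h) k) ⟩
    (a ℤ.* coeff h (suc k) ℤ.+ coeff (f *ₚ h) k) ℤ.+ (b ℤ.* coeff h (suc k) ℤ.+ coeff (g *ₚ h) k)
      ≡⟨ cong₂ ℤ._+_ (coeff-*-suc a f h k) (coeff-*-suc b g h k) ⟨
    coeff ((a ∷ f) *ₚ h) (suc k) ℤ.+ coeff ((b ∷ g) *ₚ h) (suc k)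
      ≡⟨ coeff-+ ((a ∷ f) *ₚ h) ((b ∷ g) *ₚ h) (suc k) ⟨
    coeff ((a ∷ f) *ₚ h +ₚ (b ∷ g) *ₚ h) (suc k) ∎
    where
    regroup : ∀ a b x y z → (a ℤ.+ b) ℤ.* x ℤ.+ (y ℤ.+ z) ≡ (a ℤ.* x ℤ.+ y) ℤ.+ (b ℤ.* x ℤ.+ z)
    regroup = solve-∀

  ·-*-assoc : ∀ a f g k → coeff ((a ·ₚ f) *ₚ g) k ≡ coeff (a ·ₚ (f *ₚ g)) k
  ·-*-assoc a []      g k    = refl
  ·-*-assoc a (b ∷ f) g zero = begin
    coeff ((a ℤ.* b ∷ a ·ₚ f) *ₚ g) 0   ≡⟨ coeff-*-zero (a ℤ.* b) (a ·ₚ f) g ⟩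
    a ℤ.* b ℤ.* coeff g 0               ≡⟨ ℤ.*-assoc a b (coeff g 0) ⟩
    a ℤ.* (b ℤ.* coeff g 0)             ≡⟨ cong (a ℤ.*_) (coeff-*-zero b f g) ⟨
    a ℤ.* coeff ((b ∷ f) *ₚ g) 0        ≡⟨ coeff-· a ((b ∷ f) *ₚ g) 0 ⟨
    coeff (a ·ₚ ((b ∷ f) *ₚ g)) 0       ∎
  ·-*-assoc a (b ∷ f) g (suc k) = begin
    coeff ((a ℤ.* b ∷ a ·ₚ f) *ₚ g) (suc k)
      ≡⟨ coeff-*-suc (a ℤ.* b) (a ·ₚ f) g k ⟩
    a ℤ.* b ℤ.* coeff g (suc k) ℤ.+ coeff ((a ·ₚ f) *ₚ g) k
      ≡⟨ cong (λ x → a ℤ.* b ℤ.* coeff g (suc k) ℤ.+ x) (trans (·-*-assoc a f g k) (coeff-· a (f *ₚ g) k)) ⟩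
    a ℤ.* b ℤ.* coeff g (suc k) ℤ.+ a ℤ.* coeff (f *ₚ g) k
      ≡⟨ factor a b (coeff g (suc k)) (coeff (f *ₚ g) k) ⟩
    a ℤ.* (b ℤ.* coeff g (suc k) ℤ.+ coeff (f *ₚ g) k)
      ≡⟨ cong (a ℤ.*_) (coeff-*-suc b f g k) ⟨
    a ℤ.* coeff ((b ∷ f) *ₚ g) (suc k)
      ≡⟨ coeff-· a ((b ∷ f) *ₚ g) (suc k) ⟨
    coeff (a ·ₚ ((b ∷ f) *ₚ g)) (suc k) ∎
    where
    factor : ∀ a b x y → a ℤ.* b ℤ.* x ℤ.+ a ℤ.* y ≡ a ℤ.* (b ℤ.* x ℤ.+ y)
    factor = solve-∀

  shift-* : ∀ f g k → coeff ((0ℤ ∷ f) *ₚ g) k ≡ coeff (0ℤ ∷ f *ₚ g) k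
  shift-* f g zero    = coeff-*-zero 0ℤ f g
  shift-* f g (suc k) = trans (coeff-*-suc 0ℤ f g k) (ℤ.+-identityˡ _)

  *-assoc : ∀ f g h k → coeff ((f *ₚ g) *ₚ h) k ≡ coeff (f *ₚ (g *ₚ h)) k
  *-assoc []      g h k = refl
  *-assoc (a ∷ f) g h k = begin
    coeff ((a ·ₚ g +ₚ (0ℤ ∷ f *ₚ g)) *ₚ h) k
      ≡⟨ *-distribʳ h (a ·ₚ g) (0ℤ ∷ f *ₚ g) k ⟩
    coeff ((a ·ₚ g) *ₚ h +ₚ (0ℤ ∷ f *ₚ g) *ₚ h) k
      ≡⟨ +-cong ((a ·ₚ g) *ₚ h) (a ·ₚ (g *ₚ h)) ((0ℤ ∷ f *ₚ g) *ₚ h) (0ℤ ∷ f *ₚ (g *ₚ h))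
           (·-*-assoc a g h) (λ k → trans (shift-* (f *ₚ g) h k) (shift-cong (*-assoc f g h) k)) k ⟩
    coeff (a ·ₚ (g *ₚ h) +ₚ (0ℤ ∷ f *ₚ (g *ₚ h))) k ∎

  *-identityˡ : ∀ f k → coeff (const 1ℤ *ₚ f) k ≡ coeff f k
  *-identityˡ f zero    = trans (coeff-*-zero 1ℤ [] f) (ℤ.*-identityˡ _)
  *-identityˡ f (suc k) = trans (coeff-*-suc 1ℤ [] f k) (trans (ℤ.+-identityʳ _) (ℤ.*-identityˡ _))

ℤ[t] : CommutativeRing 0ℓ 0ℓ
ℤ[t] = record
  { Carrier = Poly
  ; _≈_ = _≈ₚ_
  ; _+_ = _+ₚ_
  ; _*_ = _*ₚ_
  ; -_ = -ₚ_
  ; 0# = []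
  ; 1# = const 1ℤ
  ; isCommutativeRing = record
    { isRing = record
      { +-isAbelianGroup = record
        { isGroup = record
          { isMonoid = record
            { isSemigroup = record
              { isMagma = record
                { isEquivalence = record
                  { refl = coeffwise λ k → refl
                  ; sym = λ eq → coeffwise λ k → sym (coeff-≡ eq k)
                  ; trans = λ eq eq′ → coeffwise λ k → trans (coeff-≡ eq k) (coeff-≡ eq′ k)
                  }
                ; ∙-cong = λ {f} {f′} {g} {g′} eq eq′ → coeffwise (+-cong f f′ g g′ (coeff-≡ eq) (coeff-≡ eq′))
                }
              ; assoc = λ f g h → coeffwise (+-assoc f g h)
              }
            ; identity = (λ f → coeffwise λ k → refl)
                       , (λ f → coeffwise λ k → trans (coeff-+ f [] k) (ℤ.+-identityʳ _))
            }
          ; inverse = (λ f → coeffwise λ k → trans (+-comm (-ₚ f) f k) (+-inverseʳ f k))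
                    , (λ f → coeffwise (+-inverseʳ f))
          ; ⁻¹-cong = λ {f} {g} eq → coeffwise λ k →
              trans (coeff-neg f k) (trans (cong ℤ.-_ (coeff-≡ eq k)) (sym (coeff-neg g k)))
          }
        ; comm = λ f g → coeffwise (+-comm f g)
        }
      ; *-cong = λ {f} {f′} {g} {g′} eq eq′ → coeffwise λ k →
          trans (*-congʳ f f′ g (coeff-≡ eq) k)
          (trans (*-comm f′ g k)
          (trans (*-congʳ g g′ f′ (coeff-≡ eq′) k) (*-comm g′ f′ k)))
      ; *-assoc = λ f g h → coeffwise (*-assoc f g h)
      ; *-identity = (λ f → coeffwise (*-identityˡ f))
                   , (λ f → coeffwise λ k → trans (*-comm f (const 1ℤ) k) (*-identityˡ f k))
      ; distrib = (λ f g h → coeffwise λ k →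
                    trans (*-comm f (g +ₚ h) k)
                    (trans (*-distribʳ f g h k)
                    (+-cong (g *ₚ f) (f *ₚ g) (h *ₚ f) (f *ₚ h) (*-comm g f) (*-comm h f) k)))
                , (λ f g h → coeffwise (*-distribʳ f g h))
      }
    ; *-comm = λ f g → coeffwise (*-comm f g)
    }
  }
  where
  +-comm : ∀ f g k → coeff (f +ₚ g) k ≡ coeff (g +ₚ f) k
  +-comm f g k = trans (coeff-+ f g k) (trans (ℤ.+-comm (coeff f k) (coeff g k)) (sym (coeff-+ g f k)))

  +-assoc : ∀ f g h k → coeff (f +ₚ g +ₚ h) k ≡ coeff (f +ₚ (g +ₚ h)) k
  +-assoc f g h k = begin
    coeff (f +ₚ g +ₚ h) k                      ≡⟨ coeff-+ (f +ₚ g) h k ⟩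
    coeff (f +ₚ g) k ℤ.+ coeff h k             ≡⟨ cong (ℤ._+ coeff h k) (coeff-+ f g k) ⟩
    coeff f k ℤ.+ coeff g k ℤ.+ coeff h k      ≡⟨ ℤ.+-assoc (coeff f k) (coeff g k) (coeff h k) ⟩
    coeff f k ℤ.+ (coeff g k ℤ.+ coeff h k)    ≡⟨ cong (λ x → coeff f k ℤ.+ x) (coeff-+ g h k) ⟨
    coeff f k ℤ.+ coeff (g +ₚ h) k             ≡⟨ coeff-+ f (g +ₚ h) k ⟨
    coeff (f +ₚ (g +ₚ h)) k                    ∎

  +-inverseʳ : ∀ f k → coeff (f +ₚ -ₚ f) k ≡ 0ℤ
  +-inverseʳ f k = trans (coeff-+ f (-ₚ f) k)
    (trans (cong (λ x → coeff f k ℤ.+ x) (coeff-neg f k)) (ℤ.+-inverseʳ (coeff f k)))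

------------------------------------------------------------------------
-- Cokernels and free abelian groups

module _ (H : AbelianGroup c ℓ) (G : AbelianGroup c′ ℓ′) where

  private
    module H = AbelianGroup H
    module G = AbelianGroup G

  open GroupMorphisms H.rawGroup G.rawGroup using (IsGroupHomomorphism)

  -- Equality in G / im f.
  record _≈_mod-im_ (x y : G.Carrier) (f : H.Carrier → G.Carrier) : Set (c ⊔ ℓ′) where
    constructor _,_
    field
      preimage   : H.Carrier
      difference : x G.∙ y G.⁻¹ G.≈ f preimage

  Cokernel : (f : H.Carrier → G.Carrier) → IsGroupHomomorphism f → AbelianGroup c′ (c ⊔ ℓ′)
  Cokernel f f-hom = record
    { Carrier = G.Carrier
    ; _≈_ = λ x y → x ≈ y mod-im f
    ; _∙_ = G._∙_
    ; ε = G.ε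
    ; _⁻¹ = G._⁻¹
    ; isAbelianGroup = record
      { isGroup = record
        { isMonoid = record
          { isSemigroup = record
            { isMagma = record
              { isEquivalence = record { refl = ≈⇒ G.refl ; sym = ≈-sym ; trans = ≈-trans }
              ; ∙-cong = ≈-∙-cong
              }
            ; assoc = λ x y z → ≈⇒ (G.assoc x y z)
            }
          ; identity = (λ x → ≈⇒ (G.identityˡ x)) , (λ x → ≈⇒ (G.identityʳ x))
          }
        ; inverse = (λ x → ≈⇒ (G.inverseˡ x)) , (λ x → ≈⇒ (G.inverseʳ x))
        ; ⁻¹-cong = ≈-⁻¹-cong
        }
      ; comm = λ x y → ≈⇒ (G.comm x y)
      }
    }
    where
    open IsGroupHomomorphism f-hom using (homo; ε-homo; ⁻¹-homo)
    open AbelianGroupProperties G using (⁻¹-∙-comm; ⁻¹-involutive)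
    open CommutativeSemigroupProperties G.commutativeSemigroup using (interchange)

    ≈⇒ : ∀ {x y} → x G.≈ y → x ≈ y mod-im f
    ≈⇒ {x} {y} x≈y = H.ε , G.trans (G.∙-congʳ x≈y) (G.trans (G.inverseʳ y) (G.sym ε-homo))

    ≈-⁻¹-cong : ∀ {x y} → x ≈ y mod-im f → (x G.⁻¹) ≈ (y G.⁻¹) mod-im f
    ≈-⁻¹-cong {x} {y} (a , eq) =
      (a H.⁻¹) , G.trans (⁻¹-∙-comm x (y G.⁻¹)) (G.trans (G.⁻¹-cong eq) (G.sym (⁻¹-homo a)))

    ≈-sym : ∀ {x y} → x ≈ y mod-im f → y ≈ x mod-im f
    ≈-sym {x} {y} (a , eq) = (a H.⁻¹) ,
      G.trans (G.comm y (x G.⁻¹))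
      (G.trans (G.∙-congˡ (G.sym (⁻¹-involutive y)))
      (G.trans (⁻¹-∙-comm x (y G.⁻¹)) (G.trans (G.⁻¹-cong eq) (G.sym (⁻¹-homo a)))))

    ≈-∙-cong : ∀ {x y u v} → x ≈ y mod-im f → u ≈ v mod-im f → (x G.∙ u) ≈ (y G.∙ v) mod-im f
    ≈-∙-cong {x} {y} {u} {v} (a , eq) (b , eq′) = (a H.∙ b) ,
      G.trans (G.∙-congˡ (G.sym (⁻¹-∙-comm y v)))
      (G.trans (interchange x u (y G.⁻¹) (v G.⁻¹))
      (G.trans (G.∙-cong eq eq′) (G.sym (homo a b))))

    ≈-trans : ∀ {x y z} → x ≈ y mod-im f → y ≈ z mod-im f → x ≈ z mod-im f
    ≈-trans {x} {y} {z} (a , eq) (b , eq′) = (a H.∙ b) ,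
      G.trans (G.∙-congʳ (G.sym (G.trans (G.∙-congˡ (G.inverseˡ y)) (G.identityʳ x))))
      (G.trans (G.∙-congʳ (G.sym (G.assoc x (y G.⁻¹) y)))
      (G.trans (G.assoc (x G.∙ y G.⁻¹) y (z G.⁻¹))
      (G.trans (G.∙-cong eq eq′) (G.sym (homo a b)))))

module Matℤ    = Matrices ℤ.+-*-commutativeRing
module Matℤ[t] = Matrices ℤ[t]

infix 8 ℤ^_

ℤ^_ : ℕ → AbelianGroup 0ℓ 0ℓ
ℤ^ n = Matℤ.S^ n

coker : ∀ {m n} → Matℤ.Matrix m n → AbelianGroup 0ℓ 0ℓ
coker {m} {n} A = Cokernel (ℤ^ n) (ℤ^ m) (A Matℤ.*ᵛ_) (Matℤ.*ᵛ-isGroupHomomorphism A)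

-- Free of finite rank, which for a finitely generated abelian group is
-- the same as free.
IsFree : AbelianGroup c ℓ → Set (c ⊔ ℓ)
IsFree G = ∃[ k ] Σ (Vector ℤ k → G.Carrier) (GroupMorphisms.IsGroupIsomorphism (AbelianGroup.rawGroup (ℤ^ k)) G.rawGroup)
  where module G = AbelianGroup G

------------------------------------------------------------------------
-- Up and down maps in the basis of words; column x holds the image of x.

U : ∀ r n → Matℤ.Matrix (p r (suc n)) (p r n)
U r n y x = if does (word r n x ⋖? word r (suc n) y) then 1ℤ else 0ℤ

-- D r n is the down map from rank n + 1 to rank n.
D : ∀ r n → Matℤ.Matrix (p r n) (p r (suc n))
D r n y x = if does (word r n y ⋖? word r (suc n) x) then 1ℤ else 0ℤ

DU : ∀ r n → Matℤ.Matrix (p r n) (p r n)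
DU r n = D r n Matℤ.*ᴹ U r n

DU+tI : ∀ r n → Matℤ[t].Matrix (p r n) (p r n)
DU+tI r n = (λ i j → const (DU r n i j)) Matℤ[t].+ᴹ t Matℤ[t].·ᴹ Matℤ[t].1ᴹ

{-# OPTIONS --safe #-}
module Submission where

open import Defs
open import Algebra.Bundles using (CommutativeRing; AbelianGroup)
open import Algebra.Morphism.Structures using (module GroupMorphisms)
import Algebra.Properties.Ring as RingProperties
import Algebra.Properties.Semiring.Divisibility as SemiringDivisibility
import Algebra.Properties.Semiring.Sum as SemiringSum
import Algebra.Solver.Ring.NaturalCoefficients.Default as NaturalSolver
open import Data.Bool.Base using (true; false; if_then_else_)
open import Data.Fin.Base using (Fin; zero; suc; toℕ; splitAt)
open import Data.Fin.Permutation using (↔⇒≡)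
import Data.Fin.Properties as Fin
open import Data.Integer.Base as ℤ using (ℤ; +_; -[1+_]; 0ℤ; 1ℤ)
import Data.Integer.Properties as ℤ
open import Data.Integer.Tactic.RingSolver using (solve-∀)
open import Data.List.Base using (List; []; _∷_; lookup)
open import Data.List.Membership.Propositional using (_∈_)
open import Data.List.Membership.Propositional.Properties using (∈-lookup)
open import Data.List.Properties using (≡-dec; ∷-injectiveˡ; ∷-injectiveʳ)
open import Data.List.Relation.Unary.All as All using ([]; _∷_)
open import Data.List.Relation.Unary.Any using (index)
open import Data.List.Relation.Unary.Any.Properties using (lookup-index)
open import Data.List.Relation.Unary.Unique.Propositional using (Unique; []; _∷_)
open import Data.Nat.Base as ℕ using (ℕ; zero; suc; _≤_)
import Data.Nat.Properties as ℕ
open import Data.Product using (∃-syntax; _×_; _,_; proj₁; proj₂)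
open import Data.Product.Function.NonDependent.Propositional using (_×-↔_)
open import Data.Sum using (_⊎_; inj₁; inj₂; [_,_])
open import Data.Sum.Algebra using (⊎-comm; ⊎-assoc)
open import Data.Sum.Function.Propositional using (_⊎-↔_)
open import Data.Vec.Functional using (Vector)
open import Function.Base using (_∘_; id)
open import Function.Bundles using (_↔_; _⇔_; mk↔ₛ′; mk⇔; module Inverse)
open import Function.Properties.Inverse using (↔-refl; ↔-sym; ↔-trans)
open import Level using (_⊔_; 0ℓ)
open import Relation.Binary.PropositionalEquality as ≡ using (_≡_)
open import Relation.Nullary using (Dec; ¬_; does; contradiction)
open import Relation.Nullary.Decidable using (does-⇔; dec-true; dec-false)

-- Since 2v covers w exactly when w covers v, the words of rank n + 1 split as
-- r copies of P_n and one of P_{n-1}, with U x = (x, …, x, D x) and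
-- D (x₁, …, x_r, y) = x₁ + ⋯ + x_r + U y.  The first block of U is an
-- identity, so its cokernel is free on the other blocks.
--
-- Put A_n(s) = DU_n + s, over any commutative ring, and s′ = s + r.  Then
-- A_n(s) = UD_n + s′, and in the coordinates (ζ, w) ↦ U ζ + (0, w) this is
-- the block matrix (A_{n-1}(s′) D′; 0 s′), D′ being the restriction of D to
-- the other blocks.
-- * If r ≥ 2, D′ contains an identity block, and elimination gives
--   I ⊕ s′ (I ⊕ A_{n-1}(s′)).
-- * If r = 1, D′ = U.  When a and s are coprime, elimination turns
--   (a A_n(s)  a U; 0 s) into I ⊕ a (s A_{n-1}(s + 1)  s U; 0 s + 1),
--   and s and s + 1 are coprime again.
-- As I ⊕ _ and scaling preserve the existence of a Smith form, induction on n
-- finishes the proof.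

private variable
  I J K L X Y Z : Set

-- Linear maps and isomorphisms between free modules.

module LinearMaps {c ℓ} (S : CommutativeRing c ℓ) where

  open CommutativeRing S hiding (zero)
  open RingProperties ring using (-1*x≈-x)
  open SemiringSum semiring using (sum; sum-cong-≋; ∑-distrib-+; *-distribˡ-sum)
  open NaturalSolver commutativeSemiring using (solve; _:+_; _:*_; _:=_)
  open import Relation.Binary.Reasoning.Setoid setoid

  -- Index types are arbitrary, so that block decompositions are sums `I ⊎ J` and need no arithmetic
  -- on sizes.
  V : Set → Set c
  V I = I → Carrier

  infix 4 _≋_

  _≋_ : V I → V I → Set ℓ
  x ≋ y = ∀ i → x i ≈ y i

  infix 0 _⊸_

  record _⊸_ (I J : Set) : Set (c ⊔ ℓ) where
    -- With inlined constructors this keeps conversion checking from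
    -- unfolding composite maps down to their linearity proofs.
    no-eta-equality
    constructor mk⊸
    field
      ap     : V I → V J
      cong   : ∀ {x y} → x ≋ y → ap x ≋ ap y
      linear : ∀ a x y → ap (λ i → a * x i + y i) ≋ (λ j → a * ap x j + ap y j)

    -- Linearity with coefficient -1 cancels the value at 0 against itself.
    ap-0 : ap (λ _ → 0#) ≋ (λ _ → 0#)
    ap-0 j = begin
      ap (λ _ → 0#) j                             ≈⟨ cong (λ _ → trans (sym (+-identityʳ 0#)) (+-congʳ (sym (zeroʳ (- 1#))))) j ⟩
      ap (λ _ → - 1# * 0# + 0#) j                 ≈⟨ linear (- 1#) (λ _ → 0#) (λ _ → 0#) j ⟩
      - 1# * ap (λ _ → 0#) j + ap (λ _ → 0#) j    ≈⟨ +-congʳ (-1*x≈-x _) ⟩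
      - ap (λ _ → 0#) j + ap (λ _ → 0#) j         ≈⟨ -‿inverseˡ _ ⟩
      0#                                          ∎

    ap-+ : ∀ x y → ap (λ i → x i + y i) ≋ (λ j → ap x j + ap y j)
    ap-+ x y j = begin
      ap (λ i → x i + y i) j        ≈⟨ cong (λ i → +-congʳ (sym (*-identityˡ (x i)))) j ⟩
      ap (λ i → 1# * x i + y i) j   ≈⟨ linear 1# x y j ⟩
      1# * ap x j + ap y j          ≈⟨ +-congʳ (*-identityˡ _) ⟩
      ap x j + ap y j               ∎

    ap-* : ∀ a x → ap (λ i → a * x i) ≋ (λ j → a * ap x j)
    ap-* a x j = begin
      ap (λ i → a * x i) j            ≈⟨ cong (λ i → sym (+-identityʳ _)) j ⟩
      ap (λ i → a * x i + 0#) j       ≈⟨ linear a x (λ _ → 0#) j ⟩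
      a * ap x j + ap (λ _ → 0#) j    ≈⟨ +-congˡ (ap-0 j) ⟩
      a * ap x j + 0#                 ≈⟨ +-identityʳ _ ⟩
      a * ap x j                      ∎

    ap-sum : ∀ n (y : Fin n → V I) → ap (λ i → sum (λ k → y k i)) ≋ (λ j → sum (λ k → ap (y k) j))
    ap-sum zero    y j = ap-0 j
    ap-sum (suc n) y j = trans (ap-+ (y zero) (λ i → sum (λ k → y (suc k) i)) j) (+-congˡ (ap-sum n (y ∘ suc) j))

  {-# INLINE mk⊸ #-}

  open _⊸_ public

  pull : (J → I) → I ⊸ J
  pull f = record { ap = _∘ f ; cong = λ eq j → eq (f j) ; linear = λ a x y j → refl }

  idˡ : I ⊸ I
  idˡ = pull id

  π₁ : I ⊎ J ⊸ I
  π₁ = pull inj₁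

  π₂ : I ⊎ J ⊸ J
  π₂ = pull inj₂

  infixr 9 _∘ˡ_
  infixr 7 _·ˡ_
  infixl 6 _+ˡ_
  infixr 6 _⊕_

  _∘ˡ_ : J ⊸ K → I ⊸ J → I ⊸ K
  f ∘ˡ g = record
    { ap     = λ x → ap f (ap g x)
    ; cong   = λ eq → cong f (cong g eq)
    ; linear = λ a x y k → trans (cong f (linear g a x y) k) (linear f a (ap g x) (ap g y) k)
    }

  _+ˡ_ : I ⊸ J → I ⊸ J → I ⊸ J
  f +ˡ g = record
    { ap     = λ x j → ap f x j + ap g x j
    ; cong   = λ eq j → +-cong (cong f eq j) (cong g eq j)
    ; linear = λ a x y j → trans (+-cong (linear f a x y j) (linear g a x y j))
        (solve 5 (λ a b c d e → (a :* b :+ c) :+ (a :* d :+ e) := a :* (b :+ d) :+ (c :+ e)) refl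
           a (ap f x j) (ap f y j) (ap g x j) (ap g y j))
    }

  diag : V I → I ⊸ I
  diag d = record
    { ap     = λ x i → d i * x i
    ; cong   = λ eq i → *-congˡ (eq i)
    ; linear = λ a x y i → solve 4 (λ d a x y → d :* (a :* x :+ y) := a :* (d :* x) :+ d :* y) refl (d i) a (x i) (y i)
    }

  _·ˡ_ : Carrier → I ⊸ J → I ⊸ J
  a ·ˡ f = diag (λ _ → a) ∘ˡ f

  ⟨_,_⟩ : K ⊸ I → K ⊸ J → K ⊸ I ⊎ J
  ⟨ f , g ⟩ = record
    { ap     = λ x → [ ap f x , ap g x ]
    ; cong   = λ eq → [ cong f eq , cong g eq ]
    ; linear = λ a x y → [ linear f a x y , linear g a x y ]
    }

  _⊕_ : I ⊸ J → K ⊸ L → I ⊎ K ⊸ J ⊎ L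
  f ⊕ g = ⟨ f ∘ˡ π₁ , g ∘ˡ π₂ ⟩

  infix 0 _≅_

  record _≅_ (I J : Set) : Set (c ⊔ ℓ) where
    no-eta-equality
    constructor mk≅
    field
      to      : I ⊸ J
      from    : J ⊸ I
      to-from : ∀ y → ap to (ap from y) ≋ y
      from-to : ∀ x → ap from (ap to x) ≋ x

  {-# INLINE mk≅ #-}

  open _≅_ public

  ≅-id : I ≅ I
  ≅-id = record { to = idˡ ; from = idˡ ; to-from = λ y j → refl ; from-to = λ x i → refl }

  ≅-sym : I ≅ J → J ≅ I
  ≅-sym φ = record { to = from φ ; from = to φ ; to-from = from-to φ ; from-to = to-from φ }

  infixr 9 _∘≅_
  infixr 6 _⊕≅_

  _∘≅_ : J ≅ K → I ≅ J → I ≅ K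
  φ ∘≅ ψ = record
    { to      = to φ ∘ˡ to ψ
    ; from    = from ψ ∘ˡ from φ
    ; to-from = λ y k → trans (cong (to φ) (to-from ψ (ap (from φ) y)) k) (to-from φ y k)
    ; from-to = λ x i → trans (cong (from ψ) (from-to φ (ap (to ψ) x)) i) (from-to ψ x i)
    }

  _⊕≅_ : I ≅ J → K ≅ L → I ⊎ K ≅ J ⊎ L
  φ ⊕≅ ψ = record
    { to      = to φ ⊕ to ψ
    ; from    = from φ ⊕ from ψ
    ; to-from = λ y → [ to-from φ (y ∘ inj₁) , to-from ψ (y ∘ inj₂) ]
    ; from-to = λ x → [ from-to φ (x ∘ inj₁) , from-to ψ (x ∘ inj₂) ]
    }

  reindex : I ↔ J → I ≅ J
  reindex θ = record
    { to      = pull θ.from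
    ; from    = pull θ.to
    ; to-from = λ y j → reflexive (≡.cong y (θ.strictlyInverseˡ j))
    ; from-to = λ x i → reflexive (≡.cong x (θ.strictlyInverseʳ i))
    }
    where module θ = Inverse θ

  -- Subtraction is written with the factor `- 1#`, which the semiring solver can treat as one more
  -- variable.
  x+y-y : ∀ x y → (x + y) + - 1# * y ≈ x
  x+y-y x y = begin
    (x + y) + - 1# * y  ≈⟨ +-congˡ (-1*x≈-x y) ⟩
    (x + y) + - y       ≈⟨ +-assoc x y (- y) ⟩
    x + (y + - y)       ≈⟨ +-congˡ (-‿inverseʳ y) ⟩
    x + 0#              ≈⟨ +-identityʳ x ⟩
    x                   ∎

  x-y+y : ∀ x y → (x + - 1# * y) + y ≈ x
  x-y+y x y = begin
    (x + - 1# * y) + y  ≈⟨ +-assoc x _ y ⟩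
    x + (- 1# * y + y)  ≈⟨ +-congˡ (+-comm _ y) ⟩
    x + (y + - 1# * y)  ≈⟨ sym (+-assoc x y _) ⟩
    (x + y) + - 1# * y  ≈⟨ x+y-y x y ⟩
    x                   ∎

  -- The block elementary matrix (1 f; 0 1), with inverse (1 -f; 0 1). The eliminations below are
  -- composed of these, of permutations and sign changes, and of `unimodular`.
  shear : J ⊸ I → I ⊎ J ≅ I ⊎ J
  shear f = record
    { to      = ⟨ π₁ +ˡ f ∘ˡ π₂ , π₂ ⟩
    ; from    = ⟨ π₁ +ˡ (- 1#) ·ˡ f ∘ˡ π₂ , π₂ ⟩
    ; to-from = λ y → [ (λ i → x-y+y (y (inj₁ i)) (ap f (y ∘ inj₂) i)) , (λ j → refl) ]
    ; from-to = λ x → [ (λ i → x+y-y (x (inj₁ i)) (ap f (x ∘ inj₂) i)) , (λ j → refl) ]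
    }

  negate : I ≅ I
  negate = record
    { to      = (- 1#) ·ˡ idˡ
    ; from    = (- 1#) ·ˡ idˡ
    ; to-from = λ y i → neg-neg (y i)
    ; from-to = λ x i → neg-neg (x i)
    }
    where
    neg-neg : ∀ x → - 1# * (- 1# * x) ≈ x
    neg-neg x = begin
      - 1# * (- 1# * x)               ≈⟨ sym (+-identityˡ _) ⟩
      0# + - 1# * (- 1# * x)          ≈⟨ +-congʳ (sym (-‿inverseʳ x)) ⟩
      (x + - x) + - 1# * (- 1# * x)   ≈⟨ +-congʳ (+-congˡ (sym (-1*x≈-x x))) ⟩
      (x + - 1# * x) + - 1# * (- 1# * x) ≈⟨ x+y-y x (- 1# * x) ⟩
      x ∎

  -- The hypothesis says that (a v; s ν) has determinant −1.
  module _ {a s v ν : Carrier} (vs≈1+νa : v * s ≈ 1# + ν * a) where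

    private
      mix : Carrier → Carrier → Carrier → Carrier → I ⊎ I ⊸ I ⊎ I
      mix a b c d = ⟨ a ·ˡ π₁ +ˡ b ·ˡ π₂ , c ·ˡ π₁ +ˡ d ·ˡ π₂ ⟩

      det : v * s + - 1# * (ν * a) ≈ 1#
      det = trans (+-congʳ vs≈1+νa) (x+y-y 1# (ν * a))

      null : ∀ x → x + - 1# * x ≈ 0#
      null x = trans (+-congʳ (sym (+-identityˡ x))) (x+y-y 0# x)

      -- The common shape of the four products of matrix and inverse: the wanted coordinate carries
      -- the factor v s - ν a = 1, the other one a factor that cancels.
      keepˡ : ∀ {b z} x y → z ≈ (v * s + - 1# * (ν * a)) * x + (b + - 1# * b) * y → z ≈ x
      keepˡ {b} x y eq = trans eq (trans (+-cong (trans (*-congʳ det) (*-identityˡ x)) (trans (*-congʳ (null b)) (zeroˡ y))) (+-identityʳ x))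

    -- At determinant -1 the inverse is minus the adjugate, (-ν v; s -a).
    unimodular : I ⊎ I ≅ I ⊎ I
    unimodular = record
      { to      = mix a v s ν
      ; from    = mix (- 1# * ν) v s (- 1# * a)
      ; to-from = λ y →
          [ (λ i → keepˡ (y (inj₁ i)) (y (inj₂ i)) (solve 7 (λ a s v ν n x y →
              a :* (n :* ν :* x :+ v :* y) :+ v :* (s :* x :+ n :* a :* y)
              := (v :* s :+ n :* (ν :* a)) :* x :+ (a :* v :+ n :* (a :* v)) :* y) refl a s v ν (- 1#) (y (inj₁ i)) (y (inj₂ i))))
          , (λ i → keepˡ (y (inj₂ i)) (y (inj₁ i)) (solve 7 (λ a s v ν n x y →
              s :* (n :* ν :* y :+ v :* x) :+ ν :* (s :* y :+ n :* a :* x)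
              := (v :* s :+ n :* (ν :* a)) :* x :+ (s :* ν :+ n :* (s :* ν)) :* y) refl a s v ν (- 1#) (y (inj₂ i)) (y (inj₁ i)))) ]
      ; from-to = λ y →
          [ (λ i → keepˡ (y (inj₁ i)) (y (inj₂ i)) (solve 7 (λ a s v ν n x y →
              n :* ν :* (a :* x :+ v :* y) :+ v :* (s :* x :+ ν :* y)
              := (v :* s :+ n :* (ν :* a)) :* x :+ (ν :* v :+ n :* (ν :* v)) :* y) refl a s v ν (- 1#) (y (inj₁ i)) (y (inj₂ i))))
          , (λ i → keepˡ (y (inj₂ i)) (y (inj₁ i)) (solve 7 (λ a s v ν n x y →
              s :* (a :* y :+ v :* x) :+ n :* a :* (s :* y :+ ν :* x)
              := (v :* s :+ n :* (ν :* a)) :* x :+ (s :* a :+ n :* (s :* a)) :* y) refl a s v ν (- 1#) (y (inj₂ i)) (y (inj₁ i)))) ]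
      }

⊎-swap : (X ⊎ Y) ↔ (Y ⊎ X)
⊎-swap = ⊎-comm _ _

⊎-assocˡ : (X ⊎ (Y ⊎ Z)) ↔ ((X ⊎ Y) ⊎ Z)
⊎-assocˡ = ↔-sym (⊎-assoc 0ℓ _ _ _)

⊎-rotate : (X ⊎ (Y ⊎ Z)) ↔ (Z ⊎ (X ⊎ Y))
⊎-rotate = ↔-trans ⊎-assocˡ ⊎-swap

-- Equivalence of square matrices and existence of Smith forms.

module Equivalence {c ℓ} (S : CommutativeRing c ℓ) where

  open CommutativeRing S hiding (zero)
  open LinearMaps S
  open SemiringDivisibility semiring using (_∣_; _,_)
  open NaturalSolver commutativeSemiring using (solve; _:+_; _:*_; _:=_)
  open import Relation.Binary.Reasoning.Setoid setoid

  infix 4 _~_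

  -- The bijection is unrelated to the isomorphisms; it records that the
  -- two square matrices have the same size.
  record _~_ {I J : Set} (f : I ⊸ I) (g : J ⊸ J) : Set (c ⊔ ℓ) where
    field
      size : I ↔ J
      src  : J ≅ I
      tgt  : J ≅ I
      comm : ∀ y → ap f (ap (to src) y) ≋ ap (to tgt) (ap g y)

  open _~_ public

  ~-trans : ∀ {f : I ⊸ I} {g : J ⊸ J} {h : K ⊸ K} → f ~ g → g ~ h → f ~ h
  ~-trans p q = record
    { size = ↔-trans (size p) (size q)
    ; src  = src p ∘≅ src q
    ; tgt  = tgt p ∘≅ tgt q
    ; comm = λ y i → trans (comm p (ap (to (src q)) y) i) (cong (to (tgt p)) (comm q y) i)
    }

  ~-reindex : ∀ {f : I ⊸ I} {g : J ⊸ J} (θ : J ↔ I) →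
    (∀ y → ap f (y ∘ Inverse.from θ) ≋ ap g y ∘ Inverse.from θ) → f ~ g
  ~-reindex θ eq = record { size = ↔-sym θ ; src = reindex θ ; tgt = reindex θ ; comm = eq }

  ⊕-cong : ∀ {f : I ⊸ I} {g : J ⊸ J} {h : K ⊸ K} {k : L ⊸ L} → f ~ g → h ~ k → f ⊕ h ~ g ⊕ k
  ⊕-cong p q = record
    { size = size p ⊎-↔ size q
    ; src  = src p ⊕≅ src q
    ; tgt  = tgt p ⊕≅ tgt q
    ; comm = λ y → [ comm p (y ∘ inj₁) , comm q (y ∘ inj₂) ]
    }

  ·-cong : ∀ {f : I ⊸ I} {g : J ⊸ J} a → f ~ g → a ·ˡ f ~ a ·ˡ g
  ·-cong {g = g} a p = record
    { size = size p
    ; src  = src p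
    ; tgt  = tgt p
    ; comm = λ y i → trans (*-congˡ (comm p y i)) (sym (ap-* (to (tgt p)) a (ap g y) i))
    }

  -- The diagonal has its own numbering by `Fin dim`, so `I` needs none. Divisibility is asked for
  -- all i ≤ j, not only for neighbours, which is easier to carry through `smith-id⊕`.
  record Smith {I : Set} (f : I ⊸ I) : Set (c ⊔ ℓ) where
    field
      dim   : ℕ
      d     : V (Fin dim)
      chain : ∀ i j → toℕ i ℕ.≤ toℕ j → d i ∣ d j
      equiv : f ~ diag d

  open Smith

  smith-resp-~ : {f : I ⊸ I} {g : J ⊸ J} → f ~ g → Smith g → Smith f
  smith-resp-~ p s = record { dim = dim s ; d = d s ; chain = chain s ; equiv = ~-trans p (equiv s) }

  smith-· : ∀ {f : I ⊸ I} a → Smith f → Smith (a ·ˡ f)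
  smith-· a s = record
    { dim   = dim s
    ; d     = λ i → a * d s i
    ; chain = λ i j i≤j → let (q , eq) = chain s i j i≤j in
        q , trans (solve 3 (λ q a d → q :* (a :* d) := a :* (q :* d)) refl q a (d s i)) (*-congˡ eq)
    ; equiv = ~-trans (·-cong a (equiv s)) (~-reindex ↔-refl (λ y i → sym (*-assoc a (d s i) (y i))))
    }

  -- The new ones go in front of the chain, since 1 divides everything.
  smith-id⊕ : ∀ {m} {f : I ⊸ I} → J ↔ Fin m → Smith f → Smith (idˡ {J} ⊕ f)
  smith-id⊕ {m = m} {f} θ s = record
    { dim   = m ℕ.+ dim s
    ; d     = λ i → e (splitAt m i)
    ; chain = chain′
    ; equiv = ~-trans (⊕-cong 1~ (equiv s)) (~-reindex Fin.+↔⊎ λ y →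
        [ (λ i → scale-at y (Fin.splitAt-↑ˡ m i (dim s)) (sym (*-identityˡ _)))
        , (λ i → scale-at y (Fin.splitAt-↑ʳ m (dim s) i) refl) ])
    }
    where
    e : V (Fin m ⊎ Fin (dim s))
    e = [ (λ _ → 1#) , d s ]

    1~ : idˡ ~ idˡ {Fin m}
    1~ = ~-reindex (↔-sym θ) (λ y i → refl)

    scale-at : ∀ (y : V (Fin (m ℕ.+ dim s))) {i j x} → splitAt m i ≡ j → x ≈ e j * y i → x ≈ e (splitAt m i) * y i
    scale-at y ≡.refl eq = eq

    chain′ : ∀ i j → toℕ i ℕ.≤ toℕ j → e (splitAt m i) ∣ e (splitAt m j)
    chain′ i j i≤j with splitAt m i in eqᵢ | splitAt m j in eqⱼ
    ... | inj₁ _ | q      = e q , *-identityʳ (e q)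
    ... | inj₂ a | inj₂ b = chain s a b (ℕ.+-cancelˡ-≤ m _ _
          (≡.subst₂ ℕ._≤_ (toℕ-↑ʳ eqᵢ) (toℕ-↑ʳ eqⱼ) i≤j))
      where
      toℕ-↑ʳ : ∀ {i} {a : Fin (dim s)} → splitAt m i ≡ inj₂ a → toℕ i ≡ m ℕ.+ toℕ a
      toℕ-↑ʳ eq = ≡.trans (≡.cong toℕ (≡.sym (Fin.splitAt⁻¹-↑ʳ eq))) (Fin.toℕ-↑ʳ m _)
    -- Indices of the first block are below m and those of the second are not, so i ≤ j fails here.
    ... | inj₂ a | inj₁ b = contradiction i≤j (ℕ.<⇒≱ (j<i eqᵢ eqⱼ))
      where
      j<i : splitAt m i ≡ inj₂ a → splitAt m j ≡ inj₁ b → toℕ j ℕ.< toℕ i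
      j<i p q = ≡.subst₂ ℕ._<_
        (≡.trans (≡.sym (Fin.toℕ-↑ˡ b (dim s))) (≡.cong toℕ (Fin.splitAt⁻¹-↑ˡ q)))
        (≡.trans (≡.sym (Fin.toℕ-↑ʳ m a)) (≡.cong toℕ (Fin.splitAt⁻¹-↑ʳ p)))
        (ℕ.≤-trans (Fin.toℕ<n b) (ℕ.m≤m+n m (toℕ a)))

  -- A vector on one point is a multiple of the constant vector 1, so the value of f there is the
  -- only entry.
  smith-singleton : (f : I ⊸ I) → I ↔ Fin 1 → Smith f
  smith-singleton {I} f θ = record
    { dim   = 1
    ; d     = λ _ → ap f (λ _ → 1#) (θ.from zero)
    ; chain = λ _ _ _ → 1# , *-identityˡ _
    ; equiv = ~-reindex (↔-sym θ) eq
    }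
    where
    module θ = Inverse θ

    unique : ∀ (k : Fin 1) → k ≡ zero
    unique zero = ≡.refl

    eq : ∀ y i → ap f (y ∘ θ.to) i ≈ ap f (λ _ → 1#) (θ.from zero) * y (θ.to i)
    eq y i = begin
      ap f (y ∘ θ.to) i                       ≈⟨ cong f (λ j → trans (reflexive (≡.cong y (≡.trans (unique _) (≡.sym (unique _))))) (sym (*-identityʳ _))) i ⟩
      ap f (λ _ → y (θ.to i) * 1#) i          ≈⟨ ap-* f (y (θ.to i)) (λ _ → 1#) i ⟩
      y (θ.to i) * ap f (λ _ → 1#) i          ≈⟨ *-comm _ _ ⟩
      ap f (λ _ → 1#) i * y (θ.to i)
        ≡⟨ ≡.cong (λ j → ap f (λ _ → 1#) j * y (θ.to i)) (≡.trans (≡.sym (θ.strictlyInverseʳ i)) (≡.cong θ.from (unique _))) ⟩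
      ap f (λ _ → 1#) (θ.from zero) * y (θ.to i) ∎

  -- The block triangular matrices (a F a B; 0 s) and their elimination.

  block : X ⊸ X → Y ⊸ X → Carrier → Carrier → X ⊎ Y ⊸ X ⊎ Y
  block F B a s = ⟨ a ·ˡ (F ∘ˡ π₁ +ˡ B ∘ˡ π₂) , s ·ˡ π₂ ⟩

  -- All that is asked of U and D is an identity as first block, which serves both r = 1 and r ≥ 2.
  module Splitting {W X J : Set} (θ : (X ⊎ J) ↔ W) (U : X ⊸ W) (D : W ⊸ X) (U′ : X ⊸ J) (D′ : J ⊸ X)
           (U-split : ∀ x → ap U x ∘ Inverse.to θ ≋ [ x , ap U′ x ])
           (D-split : ∀ w → ap D w ≋ λ i → w (Inverse.to θ (inj₁ i)) + ap D′ (w ∘ Inverse.to θ ∘ inj₂) i)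
           where

    private module θ = Inverse θ

    lowerShear : X ⊎ J ≅ X ⊎ J
    lowerShear = reindex ⊎-swap ∘≅ shear U′ ∘≅ reindex ⊎-swap

    -- (ζ , w) ↦ U ζ + (0 , w)
    adapted : X ⊎ J ≅ W
    adapted = reindex θ ∘≅ lowerShear

    on-W : ∀ {x y : V W} → x ∘ θ.to ≋ y ∘ θ.to → x ≋ y
    on-W {x} {y} eq i = ≡.subst (λ i → x i ≈ y i) (θ.strictlyInverseˡ i) (eq (θ.from i))

    adapted-θ : ∀ z → ap (to adapted) z ∘ θ.to ≋ [ z ∘ inj₁ , (λ j → z (inj₂ j) + ap U′ (z ∘ inj₁) j) ]
    adapted-θ z i = trans (reflexive (≡.cong (ap (to lowerShear) z) (θ.strictlyInverseʳ i))) (unfold i)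
      where
      unfold : ap (to lowerShear) z ≋ [ z ∘ inj₁ , (λ j → z (inj₂ j) + ap U′ (z ∘ inj₁) j) ]
      unfold = [ (λ _ → refl) , (λ _ → refl) ]

    -- In the adapted coordinates U is the inclusion of the first block. For r = 1, where U is also
    -- the off-diagonal block, this reduces that block to a scalar column.
    U-adapted : ∀ x → ap U x ≋ ap (to adapted) [ x , (λ _ → 0#) ]
    U-adapted x = on-W λ i → trans (U-split x i) (trans (add-0 i) (sym (adapted-θ [ x , (λ _ → 0#) ] i)))
      where
      add-0 : [ x , ap U′ x ] ≋ [ x , (λ j → 0# + ap U′ x j) ]
      add-0 = [ (λ _ → refl) , (λ j → sym (+-identityˡ _)) ]

    module _ {s : Carrier} (F : W ⊸ W) (G : X ⊸ X)
             (F≈ : ∀ w → ap F w ≋ λ i → s * w i + ap U (ap D w) i)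
             (G≈ : ∀ x → ap G x ≋ λ i → s * x i + ap D (ap U x) i)
             where

      -- Write φ z = U ζ + (0, w). As F = s + U D, F (φ z) = U (s ζ + D (φ z)) + (0, s w); and D (φ
      -- z) = D U ζ + D′ w, so the argument of U is G ζ + D′ w.
      adapted-comm : ∀ z → ap F (ap (to adapted) z) ≋ ap (to adapted) (ap (block G D′ 1# s) z)
      adapted-comm z = on-W λ i → trans (F≈ φz (θ.to i)) (trans (+-cong (*-congˡ (adapted-θ z i)) (U-split (ap D φz) i))
          (trans (core i) (sym (adapted-θ (ap (block G D′ 1# s) z) i))))
        where
        ζ : V X
        ζ = z ∘ inj₁

        w : V J
        w = z ∘ inj₂

        φz : V W
        φz = ap (to adapted) z

        top : ∀ i → s * ζ i + ap D φz i ≈ 1# * (ap G ζ i + ap D′ w i)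
        top i = begin
          s * ζ i + ap D φz i
            ≈⟨ +-congˡ (D-split φz i) ⟩
          s * ζ i + (φz (θ.to (inj₁ i)) + ap D′ (φz ∘ θ.to ∘ inj₂) i)
            ≈⟨ +-congˡ (+-cong (adapted-θ z (inj₁ i)) (cong D′ (λ j → adapted-θ z (inj₂ j)) i)) ⟩
          s * ζ i + (ζ i + ap D′ (λ j → w j + ap U′ ζ j) i)
            ≈⟨ +-congˡ (+-congˡ (ap-+ D′ w (ap U′ ζ) i)) ⟩
          s * ζ i + (ζ i + (ap D′ w i + ap D′ (ap U′ ζ) i))
            ≈⟨ solve 4 (λ a b c d → a :+ (b :+ (c :+ d)) := (a :+ (b :+ d)) :+ c) refl _ _ _ _ ⟩
          (s * ζ i + (ζ i + ap D′ (ap U′ ζ) i)) + ap D′ w i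
            -- U ζ has the blocks ζ and U′ ζ, so ζ + D′ U′ ζ reassembles to D U ζ.
            ≈⟨ +-congʳ (+-congˡ (+-cong (U-split ζ (inj₁ i)) (cong D′ (λ j → U-split ζ (inj₂ j)) i))) ⟨
          (s * ζ i + (ap U ζ (θ.to (inj₁ i)) + ap D′ (ap U ζ ∘ θ.to ∘ inj₂) i)) + ap D′ w i
            ≈⟨ +-congʳ (+-congˡ (D-split (ap U ζ) i)) ⟨
          (s * ζ i + ap D (ap U ζ) i) + ap D′ w i
            ≈⟨ +-congʳ (G≈ ζ i) ⟨
          ap G ζ i + ap D′ w i
            ≈⟨ *-identityˡ _ ⟨
          1# * (ap G ζ i + ap D′ w i) ∎

        bottom : ∀ j → s * (w j + ap U′ ζ j) + ap U′ (ap D φz) j ≈ s * w j + ap U′ (λ i → 1# * (ap G ζ i + ap D′ w i)) j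
        bottom j = begin
          s * (w j + ap U′ ζ j) + ap U′ (ap D φz) j
            ≈⟨ trans (+-congʳ (distribˡ s _ _)) (+-assoc _ _ _) ⟩
          s * w j + (s * ap U′ ζ j + ap U′ (ap D φz) j)
            ≈⟨ +-congˡ (linear U′ s ζ (ap D φz) j) ⟨
          s * w j + ap U′ (λ i → s * ζ i + ap D φz i) j
            ≈⟨ +-congˡ (cong U′ top j) ⟩
          s * w j + ap U′ (λ i → 1# * (ap G ζ i + ap D′ w i)) j ∎

        core : ∀ i → s * [ ζ , (λ j → w j + ap U′ ζ j) ] i + [ ap D φz , ap U′ (ap D φz) ] i
          ≈ [ (λ i → 1# * (ap G ζ i + ap D′ w i)) , (λ j → s * w j + ap U′ (λ i → 1# * (ap G ζ i + ap D′ w i)) j) ] i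
        core = [ top , bottom ]

      block-~ : F ~ block G D′ 1# s
      block-~ = record { size = ↔-sym θ ; src = adapted ; tgt = adapted ; comm = adapted-comm }

  module _ {F : X ⊸ X} {B : Y ⊸ X} {G : Y ⊸ Y} {C : Z ⊸ Y} {a s s⁺ v ν : Carrier}
           (θ : (Y ⊎ Z) ↔ X) (φ : Y ⊎ Z ≅ X)
           (Fφ : ∀ z → ap F (ap (to φ) z) ≋ ap (to φ) (ap (block G C 1# s⁺) z))
           (Bφ : ∀ y → ap B y ≋ ap (to φ) [ y , (λ _ → 0#) ])
           (vs≈1+νa : v * s ≈ 1# + ν * a)
           where

    -- On the coordinates (ζ , w) of X and y of Y the matrix is
    -- (aG aC a; 0 as⁺ 0; 0 0 s); as a and s are coprime, its last column
    -- can be turned into a unit vector.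
    block-coprime-~ : block F B a s ~ idˡ ⊕ a ·ˡ block G C s s⁺
    block-coprime-~ = record
      { size = ↔-trans (↔-sym θ ⊎-↔ ↔-refl) ⊎-swap
      -- Let q = G ζ + C w and y = η + ν a q. Since 1 + ν a = v s, the rows a (q + y) and s y become
      -- a η + v (a s q) and s η + ν (a s q): the matrix (a v; s ν) applied to (η, a s q).
      ; src  = (φ ⊕≅ ≅-id) ∘≅ reindex ⊎-swap ∘≅ shear ((ν * a) ·ˡ (G ∘ˡ π₁ +ˡ C ∘ˡ π₂))
      ; tgt  = (φ ⊕≅ ≅-id) ∘≅ reindex ⊎-assocˡ ∘≅ (≅-id ⊕≅ reindex ⊎-swap) ∘≅ reindex (↔-sym ⊎-assocˡ)
                 ∘≅ (unimodular vs≈1+νa ⊕≅ ≅-id) ∘≅ reindex ⊎-assocˡ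
      ; comm = λ y → [ top y _ (λ _ → refl) (λ _ → refl) , (λ i → solve 5 (λ s η ν a q → s :* (η :+ ν :* a :* q) := s :* η :+ ν :* (a :* (s :* q))) refl
                                         s (y (inj₁ i)) ν a (q y i)) ]
      }
      where
      q : V (Y ⊎ (Y ⊎ Z)) → V Y
      q y = ap (G ∘ˡ π₁ +ˡ C ∘ˡ π₂) (y ∘ inj₂)

      η′ : V (Y ⊎ (Y ⊎ Z)) → V Y
      η′ y i = y (inj₁ i) + ν * a * q y i

      mixed : ∀ y i → a * (1# * q y i + η′ y i) ≈ a * y (inj₁ i) + v * (a * (s * q y i))
      mixed y i = begin
        a * (1# * q y i + η′ y i)
          ≈⟨ solve 5 (λ a e q η ν → a :* (e :* q :+ (η :+ ν :* a :* q)) := a :* η :+ a :* ((e :+ ν :* a) :* q)) refl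
               a 1# (q y i) (y (inj₁ i)) ν ⟩
        a * y (inj₁ i) + a * ((1# + ν * a) * q y i)
          ≈⟨ +-congˡ (*-congˡ (*-congʳ vs≈1+νa)) ⟨
        a * y (inj₁ i) + a * (v * s * q y i)
          ≈⟨ +-congˡ (solve 4 (λ a v s q → a :* (v :* s :* q) := v :* (a :* (s :* q))) refl a v s (q y i)) ⟩
        a * y (inj₁ i) + v * (a * (s * q y i)) ∎

      top : ∀ y z → (λ i → a * y (inj₁ i) + v * (a * (s * q y i))) ≋ z ∘ inj₁ → (λ j → a * (s⁺ * y (inj₂ (inj₂ j)))) ≋ z ∘ inj₂ →
        ∀ i → a * (ap F (ap (to φ) (y ∘ inj₂)) i + ap B (η′ y) i) ≈ ap (to φ) z i
      top y z eq₁ eq₂ i = begin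
        a * (ap F (ap (to φ) (y ∘ inj₂)) i + ap B (η′ y) i)
          ≈⟨ *-congˡ (+-cong (Fφ (y ∘ inj₂) i) (Bφ (η′ y) i)) ⟩
        a * (ap (to φ) (ap (block G C 1# s⁺) (y ∘ inj₂)) i + ap (to φ) [ η′ y , (λ _ → 0#) ] i)
          ≈⟨ *-congˡ (ap-+ (to φ) _ _ i) ⟨
        a * ap (to φ) (λ j → ap (block G C 1# s⁺) (y ∘ inj₂) j + [ η′ y , (λ _ → 0#) ] j) i
          ≈⟨ ap-* (to φ) a _ i ⟨
        ap (to φ) (λ j → a * (ap (block G C 1# s⁺) (y ∘ inj₂) j + [ η′ y , (λ _ → 0#) ] j)) i
          ≈⟨ cong (to φ) [ (λ j → trans (mixed y j) (eq₁ j)) , (λ j → trans (*-congˡ (+-identityʳ _)) (eq₂ j)) ] i ⟩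
        ap (to φ) z i ∎

  module _ {F : X ⊸ X} {B : X ⊎ K ⊸ X} {B′ : K ⊸ X} {s : Carrier}
           (B-split : ∀ y → ap B y ≋ λ i → y (inj₁ i) + ap B′ (y ∘ inj₂) i)
           where

    -- On coordinates (ξ, x, k) the matrix is (F 1 B′; 0 s 0; 0 0 s). Putting x = η - B′ k - F ξ
    -- turns the first row into η and the second into s η - B′ (s k) - s F ξ. Row operations with
    -- the rows η and s k, and a sign change, leave η, s k and s F ξ.
    block-surjective-~ : block F B 1# s ~ idˡ ⊕ s ·ˡ (idˡ ⊕ F)
    block-surjective-~ = record
      { size = ↔-sym ⊎-rotate
      ; src  = reindex ⊎-rotate ∘≅ shear ((- 1#) ·ˡ (B′ ∘ˡ π₁ +ˡ F ∘ˡ π₂))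
      ; tgt  = reindex (↔-sym ⊎-assocˡ) ∘≅ (reindex ⊎-swap ⊕≅ ≅-id) ∘≅ reindex ⊎-assocˡ
                 ∘≅ shear (s ·ˡ π₁ +ˡ (- 1#) ·ˡ B′ ∘ˡ π₂) ∘≅ (negate ⊕≅ ≅-id) ∘≅ reindex ⊎-rotate
      ; comm = λ y → [ top y , [ middle y , (λ _ → refl) ] ]
      }
      where
      x : V (X ⊎ (K ⊎ X)) → V X
      x y i = y (inj₁ i) + - 1# * (ap B′ (y ∘ inj₂ ∘ inj₁) i + ap F (y ∘ inj₂ ∘ inj₂) i)

      top : ∀ y i → 1# * (ap F (y ∘ inj₂ ∘ inj₂) i + ap B _ i) ≈ y (inj₁ i)
      top y i = begin
        1# * (ap F (y ∘ inj₂ ∘ inj₂) i + ap B _ i)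
          ≈⟨ trans (*-identityˡ _) (+-congˡ (B-split _ i)) ⟩
        ap F (y ∘ inj₂ ∘ inj₂) i + (x y i + ap B′ (y ∘ inj₂ ∘ inj₁) i)
          ≈⟨ solve 3 (λ f x b → f :+ (x :+ b) := x :+ (b :+ f)) refl _ _ _ ⟩
        x y i + (ap B′ (y ∘ inj₂ ∘ inj₁) i + ap F (y ∘ inj₂ ∘ inj₂) i)
          ≈⟨ x-y+y _ _ ⟩
        y (inj₁ i) ∎

      middle : ∀ y i → s * x y i ≈ - 1# * (s * ap F (y ∘ inj₂ ∘ inj₂) i) + (s * y (inj₁ i) + - 1# * ap B′ (λ k → s * y (inj₂ (inj₁ k))) i)
      middle y i = trans
        (solve 5 (λ s η n b f → s :* (η :+ n :* (b :+ f)) := n :* (s :* f) :+ (s :* η :+ n :* (s :* b))) refl s _ (- 1#) _ _)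
        (+-congˡ (+-congˡ (*-congˡ (sym (ap-* B′ s (y ∘ inj₂ ∘ inj₁) i)))))

-- Words of a given rank as an inductive family.

-- Idx r k indexes the words of rank k − 1; the empty type Idx r 0 makes the
-- recursion of ranks uniform.
data Idx (r : ℕ) : ℕ → Set where
  ε   : Idx r 1
  one : ∀ {k} → Fin r → Idx r (suc k) → Idx r (suc (suc k))
  two : ∀ {k} → Idx r k → Idx r (suc (suc k))

toWord : ∀ {r k} → Idx r k → Word r
toWord ε         = []
toWord (one i w) = 𝟏 i ∷ toWord w
toWord (two w)   = 𝟐 ∷ toWord w

fromWord : ∀ {r} (w : Word r) → Idx r (suc (rank w))
fromWord []        = ε
fromWord (𝟏 i ∷ w) = one i (fromWord w)
fromWord (𝟐 ∷ w)   = two (fromWord w)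

toWord-fromWord : ∀ {r} (w : Word r) → toWord (fromWord w) ≡ w
toWord-fromWord []        = ≡.refl
toWord-fromWord (𝟏 i ∷ w) = ≡.cong (𝟏 i ∷_) (toWord-fromWord w)
toWord-fromWord (𝟐 ∷ w)   = ≡.cong (𝟐 ∷_) (toWord-fromWord w)

toWord-subst : ∀ {r k l} (eq : k ≡ l) (w : Idx r k) → toWord (≡.subst (Idx r) eq w) ≡ toWord w
toWord-subst ≡.refl w = ≡.refl

suc-rank : ∀ {r k} (w : Idx r k) → suc (rank (toWord w)) ≡ k
suc-rank ε         = ≡.refl
suc-rank (one i w) = ≡.cong suc (suc-rank w)
suc-rank (two w)   = ≡.cong (2 ℕ.+_) (suc-rank w)

toWord-injective : ∀ {r k} {v w : Idx r k} → toWord v ≡ toWord w → v ≡ w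
toWord-injective {v = ε}       {ε}       eq     = ≡.refl
toWord-injective {v = one i v} {one j w} eq with ≡.refl ← ∷-injectiveˡ eq = ≡.cong (one i) (toWord-injective (∷-injectiveʳ eq))
toWord-injective {v = two v}   {two w}   eq     = ≡.cong two (toWord-injective (∷-injectiveʳ eq))
toWord-injective {v = one i v} {two w}   ()
toWord-injective {v = two v}   {one i w} ()

lookup-injective : ∀ {A : Set} {xs : List A} → Unique xs → ∀ {i j} → lookup xs i ≡ lookup xs j → i ≡ j
lookup-injective (x∉ ∷ u) {zero}  {zero}  eq = ≡.refl
lookup-injective (x∉ ∷ u) {zero}  {suc j} eq = contradiction eq (All.lookup x∉ (∈-lookup j))
lookup-injective (x∉ ∷ u) {suc i} {zero}  eq = contradiction (≡.sym eq) (All.lookup x∉ (∈-lookup i))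
lookup-injective (x∉ ∷ u) {suc i} {suc j} eq = ≡.cong suc (lookup-injective u eq)

module _ (r n : ℕ) where

  private
    to : Fin (p r n) → Idx r (suc n)
    to i = ≡.subst (Idx r) (≡.cong suc (words-sound r n (∈-lookup i))) (fromWord (word r n i))

    to-word : ∀ i → toWord (to i) ≡ word r n i
    to-word i = ≡.trans (toWord-subst _ (fromWord (word r n i))) (toWord-fromWord (word r n i))

    position : (w : Idx r (suc n)) → toWord w ∈ words r n
    position w = ≡.subst (λ m → toWord w ∈ words r m) (ℕ.suc-injective (suc-rank w)) (words-complete r (toWord w))

    word-position : ∀ w → word r n (index (position w)) ≡ toWord w
    word-position w = ≡.sym (lookup-index (position w))

  -- The numbering is that of the list `words r n`, so matrices indexed by list positions can be
  -- compared with maps defined by recursion on words.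
  enumerate : Fin (p r n) ↔ Idx r (suc n)
  enumerate = mk↔ₛ′ to (index ∘ position)
    (λ w → toWord-injective (≡.trans (to-word (index (position w))) (word-position w)))
    (λ i → lookup-injective (words-unique r n) (≡.trans (word-position (to i)) (to-word i)))

  toWord-enumerate : ∀ i → toWord (Inverse.to enumerate i) ≡ word r n i
  toWord-enumerate = to-word

-- Finiteness, and splitting the words of a rank by their first letter.

Finite : Set → Set
Finite I = ∃[ m ] I ↔ Fin m

Idx-finite : ∀ r k → Finite (Idx r k)
Idx-finite r zero    = 0 , mk↔ₛ′ (λ ()) (λ ()) (λ ()) (λ ())
Idx-finite r (suc n) = p r n , ↔-sym (enumerate r n)

⊎-finite : ∀ {I J} → Finite I → Finite J → Finite (I ⊎ J)
⊎-finite (m , θ) (n , η) = m ℕ.+ n , ↔-trans (θ ⊎-↔ η) (↔-sym Fin.+↔⊎)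

×-finite : ∀ {I J} → Finite I → Finite J → Finite (I × J)
×-finite (m , θ) (n , η) = m ℕ.* n , ↔-trans (θ ×-↔ η) (↔-sym Fin.*↔×)

-- For r = m + 2 this is what remains of a rank after taking away the words that begin with one of
-- the first two letters of value 1.
Rest : ℕ → ℕ → ℕ → Set
Rest r m k = (Fin m × Idx r (suc k)) ⊎ Idx r k

Rest-finite : ∀ r m k → Finite (Rest r m k)
Rest-finite r m k = ⊎-finite (×-finite (m , ↔-refl) (Idx-finite r (suc k))) (Idx-finite r k)

split₁ : ∀ k → (Idx 1 (suc k) ⊎ Idx 1 k) ↔ Idx 1 (suc (suc k))
split₁ k = mk↔ₛ′ [ one zero , two ]
  (λ { (one zero w) → inj₁ w ; (one (suc ()) w) ; (two w) → inj₂ w })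
  (λ { (one zero w) → ≡.refl ; (one (suc ()) w) ; (two w) → ≡.refl })
  [ (λ _ → ≡.refl) , (λ _ → ≡.refl) ]

split₂ : ∀ m k → let r = suc (suc m) in
  (Idx r (suc k) ⊎ (Idx r (suc k) ⊎ Rest r m k)) ↔ Idx r (suc (suc k))
split₂ m k = mk↔ₛ′
  [ one zero , [ one (suc zero) , [ (λ (i , w) → one (suc (suc i)) w) , two ] ] ]
  (λ { (one zero w)          → inj₁ w
     ; (one (suc zero) w)    → inj₂ (inj₁ w)
     ; (one (suc (suc i)) w) → inj₂ (inj₂ (inj₁ (i , w)))
     ; (two w)               → inj₂ (inj₂ (inj₂ w)) })
  (λ { (one zero w)          → ≡.refl
     ; (one (suc zero) w)    → ≡.refl
     ; (one (suc (suc i)) w) → ≡.refl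
     ; (two w)               → ≡.refl })
  [ (λ _ → ≡.refl) , [ (λ _ → ≡.refl) , [ (λ _ → ≡.refl) , (λ _ → ≡.refl) ] ] ]

-- The up and down maps by recursion on words.

module UpDown {c ℓ} (S : CommutativeRing c ℓ) (r : ℕ) where

  open CommutativeRing S hiding (zero)
  open SemiringSum semiring using (sum; sum-cong-≋; ∑-distrib-+; *-distribˡ-sum; *-distribʳ-sum)
  open NaturalSolver commutativeSemiring using (solve; _:+_; _:*_; _:=_)
  open LinearMaps S

  mutual
    -- The recursion makes the block form of both maps hold by computation; `up-basis` and
    -- `down-basis` tie it to the covering relation. At `zero` the source is the zero module.
    up : ∀ k → V (Idx r k) → V (Idx r (suc k))
    up zero    x ε         = 0#
    up (suc k) x (one i w) = x w
    up (suc k) x (two w)   = down k x w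

    down : ∀ k → V (Idx r (suc k)) → V (Idx r k)
    down (suc k) x w = sum (λ i → x (one i w)) + up k (x ∘ two) w

  mutual
    up-cong : ∀ k {x y} → x ≋ y → up k x ≋ up k y
    up-cong zero    eq ε         = refl
    up-cong (suc k) eq (one i w) = eq w
    up-cong (suc k) eq (two w)   = down-cong k eq w

    down-cong : ∀ k {x y} → x ≋ y → down k x ≋ down k y
    down-cong (suc k) eq w = +-cong (sum-cong-≋ (λ i → eq (one i w))) (up-cong k (eq ∘ two) w)

  sum-linear : ∀ {n} a (x y : V (Fin n)) → sum (λ i → a * x i + y i) ≈ a * sum x + sum y
  sum-linear a x y = trans (∑-distrib-+ (λ i → a * x i) y) (+-congʳ (sym (*-distribˡ-sum a x)))

  mutual
    up-linear : ∀ k a x y → up k (λ i → a * x i + y i) ≋ (λ j → a * up k x j + up k y j)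
    up-linear zero    a x y ε         = sym (trans (+-identityʳ _) (zeroʳ a))
    up-linear (suc k) a x y (one i w) = refl
    up-linear (suc k) a x y (two w)   = down-linear k a x y w

    down-linear : ∀ k a x y → down k (λ i → a * x i + y i) ≋ (λ j → a * down k x j + down k y j)
    down-linear (suc k) a x y w = trans
      (+-cong (sum-linear a (λ i → x (one i w)) (λ i → y (one i w))) (up-linear k a (x ∘ two) (y ∘ two) w))
      (solve 5 (λ a s t u v → (a :* s :+ t) :+ (a :* u :+ v) := a :* (s :+ u) :+ (t :+ v)) refl a _ _ _ _)

  Up : ∀ k → Idx r k ⊸ Idx r (suc k)
  Up k = record { ap = up k ; cong = up-cong k ; linear = up-linear k }

  Down : ∀ k → Idx r (suc k) ⊸ Idx r k
  Down k = record { ap = down k ; cong = down-cong k ; linear = down-linear k }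

  -- At `k = suc n` this is A_n(s) = DU_n + s.
  DownUp : ∀ k → Carrier → Idx r k ⊸ Idx r k
  DownUp k s = s ·ˡ idˡ +ˡ Down k ∘ˡ Up k

  r# : Carrier
  r# = sum {r} (λ _ → 1#)

  -- The relation D U = U D + r of a differential poset: when D is applied to U x, the r blocks of
  -- letters 1 contribute r x and the block of the letter 2 contributes U (D x).
  DownUp-UpDown : ∀ k s x → ap (DownUp (suc k) s) x ≋ λ w → (s + r#) * x w + up k (down k x) w
  DownUp-UpDown k s x w = trans (sym (+-assoc _ _ _)) (+-congʳ (trans
    (+-congˡ (trans (sum-cong-≋ {r} (λ _ → sym (*-identityˡ (x w)))) (sym (*-distribʳ-sum (x w) (λ (_ : Fin r) → 1#)))))
    (sym (distribʳ (x w) s r#))))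

-- The induction on the rank, for r = 1 and for r ≥ 2.

module _ {c ℓ} (S : CommutativeRing c ℓ) where

  open CommutativeRing S hiding (zero)
  open LinearMaps S
  open Equivalence S
  open SemiringSum semiring using (sum; sum-cong-≋)

  private
    Idx-1 : ∀ r → Idx r 1 ↔ Fin 1
    Idx-1 r = mk↔ₛ′ (λ _ → zero) (λ _ → ε) (λ { zero → ≡.refl }) (λ { ε → ≡.refl })

  module SingleLetter where
    open UpDown S 1

    Up-split : ∀ k x → up (suc k) x ∘ Inverse.to (split₁ k) ≋ [ x , down k x ]
    Up-split k x = [ (λ _ → refl) , (λ _ → refl) ]

    Down-split : ∀ k x → down (suc k) x ≋ λ w → x (one zero w) + up k (x ∘ two) w
    Down-split k x w = +-congʳ (+-identityʳ _)

    module C k = Splitting (split₁ k) (Up (suc k)) (Down (suc k)) (Down k) (Up k) (Up-split k) (Down-split k)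

    -- Coprimality of a and s is carried as a Bézout relation. Elimination replaces the pair by s
    -- and s + 1, for which v = ν = 1 serve: 1 (s + 1) = 1 + 1 s.
    block-smith : ∀ k {a s v ν} → v * s ≈ 1# + ν * a → Smith (block (DownUp (suc k) s) (Up k) a s)
    -- The second block is indexed by the empty type `Idx 1 0`, which leaves a 1 × 1 matrix.
    block-smith zero eq = smith-singleton _
      (mk↔ₛ′ (λ _ → zero) (λ _ → inj₁ ε) (λ { zero → ≡.refl }) (λ { (inj₁ ε) → ≡.refl ; (inj₂ ()) }))
    block-smith (suc k) {a} {s} eq = smith-resp-~
      (block-coprime-~ (split₁ k) (C.adapted k)
        (C.adapted-comm k (DownUp (suc (suc k)) s) (DownUp (suc k) (s + r#)) (DownUp-UpDown (suc k) s) (λ x w → refl))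
        (C.U-adapted k)
        eq)
      (smith-id⊕ (↔-sym (enumerate 1 k)) (smith-· a (block-smith k {v = 1#} {ν = 1#}
        (trans (*-identityˡ _) (trans (+-comm s r#) (+-cong (+-identityʳ 1#) (sym (*-identityˡ s))))))))

    smith : ∀ n s → Smith (DownUp (suc n) s)
    smith zero    s = smith-singleton _ (Idx-1 1)
    smith (suc n) s = smith-resp-~
      (C.block-~ n (DownUp (suc (suc n)) s) (DownUp (suc n) (s + r#)) (DownUp-UpDown (suc n) s) (λ x w → refl))
      -- The induction starts from a = 1, coprime to everything: 0 = 1 + (-1) 1.
      (block-smith n {v = 0#} {ν = - 1#} (trans (zeroˡ _) (sym (trans (+-congˡ (*-identityʳ (- 1#))) (-‿inverseʳ 1#)))))

  module SeveralLetters (m : ℕ) where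
    private
      r : ℕ
      r = suc (suc m)

    open UpDown S r

    Up-rest : ∀ k → Idx r (suc k) ⊸ Rest r m k
    Up-rest k = ⟨ pull (λ (i , w) → w) , Down k ⟩

    Down-rest : ∀ k → Rest r m k ⊸ Idx r (suc k)
    Down-rest k = sumˡ ∘ˡ π₁ +ˡ Up k ∘ˡ π₂
      where
      sumˡ : Fin m × Idx r (suc k) ⊸ Idx r (suc k)
      sumˡ = record
        { ap     = λ x w → sum (λ i → x (i , w))
        ; cong   = λ eq w → sum-cong-≋ (λ i → eq (i , w))
        ; linear = λ a x y w → sum-linear a (λ i → x (i , w)) (λ i → y (i , w))
        }

    Up-split : ∀ k x → up (suc k) x ∘ Inverse.to (split₂ m k) ≋ [ x , ap ⟨ idˡ , Up-rest k ⟩ x ]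
    Up-split k x = [ (λ _ → refl) , [ (λ _ → refl) , [ (λ _ → refl) , (λ _ → refl) ] ] ]

    -- The second letter of value 1 supplies the identity `π₁` inside D′, as `block-surjective-~`
    -- requires.
    Down-split : ∀ k x → down (suc k) x ≋
      λ w → x (one zero w) + ap (π₁ +ˡ Down-rest k ∘ˡ π₂) (x ∘ Inverse.to (split₂ m k) ∘ inj₂) w
    Down-split k x w = trans (+-assoc _ _ _) (+-congˡ (+-assoc _ _ _))

    module C k = Splitting (split₂ m k) (Up (suc k)) (Down (suc k)) ⟨ idˡ , Up-rest k ⟩ (π₁ +ˡ Down-rest k ∘ˡ π₂)
                   (Up-split k) (Down-split k)

    smith : ∀ n s → Smith (DownUp (suc n) s)
    smith zero    s = smith-singleton _ (Idx-1 r)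
    smith (suc n) s = smith-resp-~
      (C.block-~ n (DownUp (suc (suc n)) s) (DownUp (suc n) (s + r#)) (DownUp-UpDown (suc n) s) (λ x w → refl))
      (smith-resp-~ (block-surjective-~ {B′ = Down-rest n} (λ y w → refl))
        (smith-id⊕ (↔-sym (enumerate r n)) (smith-· (s + r#)
          (smith-id⊕ (proj₂ (Rest-finite r m n)) (smith n (s + r#))))))

  DownUp-smith : ∀ r → 1 ℕ.≤ r → ∀ n s → Smith (UpDown.DownUp S r (suc n) s)
  DownUp-smith (suc zero)    _ = SingleLetter.smith
  DownUp-smith (suc (suc m)) _ = SeveralLetters.smith m

-- From linear maps to matrices.

module MatrixForm {c ℓ} (S : CommutativeRing c ℓ) where

  open CommutativeRing S hiding (zero)
  open SemiringSum semiring using (sum; sum-cong-≋; sum-replicate-zero)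
  open SemiringDivisibility semiring using (_∣_; _,_)
  open LinearMaps S
  open Equivalence S
  open Matrices S
  open import Relation.Binary.Reasoning.Setoid setoid

  ind : ∀ {a} {A : Set a} → Dec A → Carrier
  ind d = if does d then 1# else 0#

  ind-⇔ : ∀ {a b} {A : Set a} {B : Set b} → A ⇔ B → (d : Dec A) (e : Dec B) → ind d ≈ ind e
  ind-⇔ A⇔B d e = reflexive (≡.cong (if_then 1# else 0#) (does-⇔ A⇔B d e))

  ind-yes : ∀ {a} {A : Set a} (d : Dec A) → A → ind d ≈ 1#
  ind-yes d x = reflexive (≡.cong (if_then 1# else 0#) (dec-true d x))

  ind-no : ∀ {a} {A : Set a} (d : Dec A) → ¬ A → ind d ≈ 0#
  ind-no d x = reflexive (≡.cong (if_then 1# else 0#) (dec-false d x))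

  sum-1ᴹ : ∀ {n} (i : Fin n) (x : V (Fin n)) → sum (λ j → 1ᴹ i j * x j) ≈ x i
  sum-1ᴹ {suc n} zero x = begin
    1# * x zero + sum {n} (λ j → 0# * x (suc j))  ≈⟨ +-cong (*-identityˡ _) (trans (sum-cong-≋ (λ j → zeroˡ (x (suc j)))) (sum-replicate-zero n)) ⟩
    x zero + 0#                               ≈⟨ +-identityʳ _ ⟩
    x zero                                    ∎
  sum-1ᴹ (suc i) x = begin
    0# * x zero + sum (λ j → 1ᴹ i j * x (suc j))  ≈⟨ +-cong (zeroˡ _) (sum-1ᴹ i (x ∘ suc)) ⟩
    0# + x (suc i)                                ≈⟨ +-identityˡ _ ⟩
    x (suc i)                                     ∎

  entries : ∀ {m n} → Fin n ⊸ Fin m → Matrix m n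
  entries f i j = ap f (λ k → 1ᴹ k j) i

  -- Expand x in the columns of the identity matrix; f preserves finite linear combinations.
  ap-entries : ∀ {n} {K : Set} (f : Fin n ⊸ K) x → ap f x ≋ λ i → sum (λ j → ap f (λ k → 1ᴹ k j) i * x j)
  ap-entries {n} f x i = begin
    ap f x i                                      ≈⟨ cong f (λ k → trans (sum-cong-≋ (λ j → *-comm (x j) (1ᴹ k j))) (sum-1ᴹ k x)) i ⟨
    ap f (λ k → sum (λ j → x j * 1ᴹ k j)) i       ≈⟨ ap-sum f n (λ j k → x j * 1ᴹ k j) i ⟩
    sum (λ j → ap f (λ k → x j * 1ᴹ k j) i)       ≈⟨ sum-cong-≋ (λ j → trans (ap-* f (x j) (λ k → 1ᴹ k j) i) (*-comm _ _)) ⟩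
    sum (λ j → ap f (λ k → 1ᴹ k j) i * x j)       ∎

  entries-∘ : ∀ {l m n} (f : Fin m ⊸ Fin l) (g : Fin n ⊸ Fin m) → entries f *ᴹ entries g ≈ᴹ entries (f ∘ˡ g)
  entries-∘ f g i j = sym (ap-entries f (ap g (λ k → 1ᴹ k j)) i)

  *ᴹ-congˡ : ∀ {l m n} (A : Matrix l m) {B B′ : Matrix m n} → B ≈ᴹ B′ → A *ᴹ B ≈ᴹ A *ᴹ B′
  *ᴹ-congˡ A eq i j = sum-cong-≋ (λ k → *-congˡ (eq k j))

  *ᴹ-congʳ : ∀ {l m n} {A A′ : Matrix l m} (B : Matrix m n) → A ≈ᴹ A′ → A *ᴹ B ≈ᴹ A′ *ᴹ B
  *ᴹ-congʳ B eq i j = sum-cong-≋ (λ k → *-congʳ (eq i k))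

  entries-invertible : ∀ {n} (φ : Fin n ≅ Fin n) → Invertible (entries (to φ))
  entries-invertible φ = entries (from φ)
    , (λ i j → trans (entries-∘ (to φ) (from φ) i j) (to-from φ (λ k → 1ᴹ k j) i))
    , (λ i j → trans (entries-∘ (from φ) (to φ) i j) (from-to φ (λ k → 1ᴹ k j) i))

  -- The bijection `size` shows that the diagonal has n entries. Then P is the inverse of `tgt` and
  -- Q is `src`.
  hasSmithForm : ∀ {n} {A : Matrix n n} (f : Fin n ⊸ Fin n) → A ≈ᴹ entries f → Smith f → HasSmithForm A
  hasSmithForm {n} {A} f A≈f s = go (Smith.d s) (Smith.chain s) (Smith.equiv s) (↔⇒≡ (size (Smith.equiv s)))
    where
    go : ∀ {m} (d : V (Fin m)) → (∀ i j → toℕ i ℕ.≤ toℕ j → d i ∣ d j) → f ~ diag d → n ≡ m → HasSmithForm A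
    go d chain f~d ≡.refl = entries (from (tgt f~d)) , entries (to (src f~d))
      , entries-invertible (≅-sym (tgt f~d)) , entries-invertible (src f~d)
      , record
        { diagonal = λ i j i≢j → trans (B≈ i j) (trans (*-congˡ (ind-no (i Fin.≟ j) (i≢j ∘ ≡.cong toℕ))) (zeroʳ _))
        ; divides  = λ i j i⁺ j⁺ i≡j i⁺≡ j⁺≡ →
            let (q , eq) = chain i i⁺ (ℕ.≤-trans (ℕ.n≤1+n _) (ℕ.≤-reflexive (≡.sym i⁺≡))) in
            q , trans (*-congˡ (on-diagonal i j i≡j))
                  (trans eq (sym (on-diagonal i⁺ j⁺ (≡.trans i⁺≡ (≡.trans (≡.cong suc i≡j) (≡.sym j⁺≡))))))
        }
      where
      B : Matrix n n
      B = entries (from (tgt f~d)) *ᴹ A *ᴹ entries (to (src f~d))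

      B≈ : ∀ i j → B i j ≈ d i * 1ᴹ i j
      B≈ i j = begin
        B i j
          ≈⟨ *ᴹ-congʳ (entries (to (src f~d))) (λ i k → trans (*ᴹ-congˡ (entries (from (tgt f~d))) A≈f i k) (entries-∘ (from (tgt f~d)) f i k)) i j ⟩
        (entries (from (tgt f~d) ∘ˡ f) *ᴹ entries (to (src f~d))) i j
          ≈⟨ entries-∘ (from (tgt f~d) ∘ˡ f) (to (src f~d)) i j ⟩
        ap (from (tgt f~d)) (ap f (ap (to (src f~d)) (λ k → 1ᴹ k j))) i
          ≈⟨ cong (from (tgt f~d)) (comm f~d (λ k → 1ᴹ k j)) i ⟩
        ap (from (tgt f~d)) (ap (to (tgt f~d)) (ap (diag d) (λ k → 1ᴹ k j))) i
          ≈⟨ from-to (tgt f~d) (ap (diag d) (λ k → 1ᴹ k j)) i ⟩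
        d i * 1ᴹ i j ∎

      on-diagonal : ∀ i j → toℕ i ≡ toℕ j → B i j ≈ d i
      on-diagonal i j eq = trans (B≈ i j) (trans (*-congˡ (ind-yes (i Fin.≟ j) (Fin.toℕ-injective eq))) (*-identityʳ _))

-- The covering relation and the entries of the up and down maps.

private
  𝟐∷⁺ : ∀ {r} {w′ w : Word r} → w′ ⋖ w → 𝟐 ∷ w′ ⋖ 𝟐 ∷ w
  𝟐∷⁺ (change i v us) = change i v (≡.refl ∷ us)
  𝟐∷⁺ (delete i v us) = delete i v (≡.refl ∷ us)

-- Change and deletion trade places. For u a run of 2s, deleting 1_i from 2 u 1_i v leaves 2 u v = u
-- 2 v, and changing the last 2 of the run 2 u in 2 u v gives u 1_i v.
⋖-reflect⁺ : ∀ {r} {v w : Word r} → v ⋖ w → w ⋖ 𝟐 ∷ v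
⋖-reflect⁺ (change i v [])            = delete i v (≡.refl ∷ [])
⋖-reflect⁺ (change i v (≡.refl ∷ us)) = 𝟐∷⁺ (⋖-reflect⁺ (change i v us))
⋖-reflect⁺ (delete i v [])            = change i v []
⋖-reflect⁺ (delete i v (≡.refl ∷ us)) = 𝟐∷⁺ (⋖-reflect⁺ (delete i v us))

-- Covers sorted by the first letter of the upper word: the indices of `_⋖_` are concatenations,
-- which block direct matching on a given upper word.
data Lower {r} : Word r → Word r → Set where
  changeHead : ∀ i v → Lower (𝟏 i ∷ v) (𝟐 ∷ v)
  deleteHead : ∀ i v → Lower v (𝟏 i ∷ v)
  keepHead   : ∀ {v w} → v ⋖ w → Lower (𝟐 ∷ v) (𝟐 ∷ w)

lower : ∀ {r} {v w : Word r} → v ⋖ w → Lower v w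
lower (change i v [])            = changeHead i v
lower (change i v (≡.refl ∷ us)) = keepHead (change i v us)
lower (delete i v [])            = deleteHead i v
lower (delete i v (≡.refl ∷ us)) = keepHead (delete i v us)

⋖-reflect : ∀ {r} {v w : Word r} → (v ⋖ w) ⇔ (w ⋖ 𝟐 ∷ v)
⋖-reflect {v = v} {w} = mk⇔ ⋖-reflect⁺ (λ w⋖2v → go (lower w⋖2v))
  where
  go : ∀ {w} → Lower w (𝟐 ∷ v) → v ⋖ w
  go (changeHead i v) = delete i v []
  go (keepHead w⋖v)   = ⋖-reflect⁺ w⋖v

-- A head 1_i blocks every change further right and is itself the letter to be deleted.
≡⇔⋖-𝟏 : ∀ {r} {v w : Word r} {i} → (v ≡ w) ⇔ (v ⋖ 𝟏 i ∷ w)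
≡⇔⋖-𝟏 {v = v} {w} {i} = mk⇔ (λ { ≡.refl → delete i w [] }) (λ v⋖ → go (lower v⋖))
  where
  go : ∀ {v} → Lower v (𝟏 i ∷ w) → v ≡ w
  go (deleteHead i w) = ≡.refl

module UpDownMatrices {c ℓ} (S : CommutativeRing c ℓ) (r : ℕ) where

  open CommutativeRing S hiding (zero)
  open SemiringSum semiring using (sum; sum-cong-≋; sum-replicate-zero)
  open LinearMaps S
  open Equivalence S
  open MatrixForm S
  open Matrices S
  open UpDown S r
  open import Relation.Binary.Reasoning.Setoid setoid

  basis : ∀ {k} → Idx r k → V (Idx r k)
  basis w v = ind (≡-dec _≟ˡ_ (toWord w) (toWord v))

  mutual
    -- Mutual induction along `up` and `down`: a head 1_i asks for equality with the tail, while a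
    -- head 2 exchanges the two maps, which `⋖-reflect` matches on covers.
    up-basis : ∀ k (w : Idx r k) y → up k (basis w) y ≈ ind (toWord w ⋖? toWord y)
    up-basis (suc k) w (one i y) = ind-⇔ ≡⇔⋖-𝟏 (≡-dec _≟ˡ_ (toWord w) (toWord y)) (toWord w ⋖? 𝟏 i ∷ toWord y)
    up-basis (suc k) w (two y)   = trans (down-basis k w y) (ind-⇔ ⋖-reflect (toWord y ⋖? toWord w) (toWord w ⋖? 𝟐 ∷ toWord y))

    down-basis : ∀ k (w : Idx r (suc k)) y → down k (basis w) y ≈ ind (toWord y ⋖? toWord w)
    down-basis (suc k) (one i w) y = begin
      sum (λ j → basis (one i w) (one j y)) + up k (λ v → basis (one i w) (two v)) y
        ≈⟨ +-cong (sum-cong-≋ letter) (trans (up-cong k (λ v → ind-no (≡-dec _≟ˡ_ (𝟏 i ∷ toWord w) (𝟐 ∷ toWord v)) λ ()) y) (ap-0 (Up k) y)) ⟩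
      sum (λ j → 1ᴹ i j * basis w y) + 0#
        ≈⟨ trans (+-identityʳ _) (sum-1ᴹ i (λ _ → basis w y)) ⟩
      basis w y
        ≈⟨ ind-⇔ (mk⇔ ≡.sym ≡.sym) (≡-dec _≟ˡ_ (toWord w) (toWord y)) (≡-dec _≟ˡ_ (toWord y) (toWord w)) ⟩
      basis y w
        ≈⟨ ind-⇔ ≡⇔⋖-𝟏 (≡-dec _≟ˡ_ (toWord y) (toWord w)) (toWord y ⋖? 𝟏 i ∷ toWord w) ⟩
      ind (toWord y ⋖? 𝟏 i ∷ toWord w) ∎
      where
      letter : ∀ j → basis (one i w) (one j y) ≈ 1ᴹ i j * basis w y
      letter j with does (i Fin.≟ j)
      ... | true  = sym (*-identityˡ _)
      ... | false = sym (zeroˡ _)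
    down-basis (suc k) (two w) y = begin
      sum (λ j → basis (two w) (one j y)) + up k (λ v → basis (two w) (two v)) y
        ≈⟨ +-cong (trans (sum-cong-≋ (λ j → ind-no (≡-dec _≟ˡ_ (𝟐 ∷ toWord w) (𝟏 j ∷ toWord y)) λ ())) (sum-replicate-zero r))
                  (up-cong k (λ v → ind-⇔ (mk⇔ ∷-injectiveʳ (≡.cong (𝟐 ∷_)))
                                  (≡-dec _≟ˡ_ (𝟐 ∷ toWord w) (𝟐 ∷ toWord v)) (≡-dec _≟ˡ_ (toWord w) (toWord v))) y) ⟩
      0# + up k (basis w) y
        ≈⟨ trans (+-identityˡ _) (up-basis k w y) ⟩
      ind (toWord w ⋖? toWord y)
        ≈⟨ ind-⇔ ⋖-reflect (toWord w ⋖? toWord y) (toWord y ⋖? 𝟐 ∷ toWord w) ⟩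
      ind (toWord y ⋖? 𝟐 ∷ toWord w) ∎

  private
    module E n = Inverse (enumerate r n)

  basis-enumerate : ∀ n j w → 1ᴹ (E.from n w) j ≈ basis (E.to n j) w
  basis-enumerate n j w = ind-⇔ (mk⇔
      (λ { ≡.refl → ≡.cong toWord (E.strictlyInverseˡ n w) })
      (λ eq → ≡.trans (≡.cong (E.from n) (≡.sym (toWord-injective eq))) (E.strictlyInverseʳ n j)))
    (E.from n w Fin.≟ j) (≡-dec _≟ˡ_ (toWord (E.to n j)) (toWord w))

  Upᶠ : ∀ n → Fin (p r n) ⊸ Fin (p r (suc n))
  Upᶠ n = pull (E.to (suc n)) ∘ˡ Up (suc n) ∘ˡ pull (E.from n)

  Downᶠ : ∀ n → Fin (p r (suc n)) ⊸ Fin (p r n)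
  Downᶠ n = pull (E.to n) ∘ˡ Down (suc n) ∘ˡ pull (E.from (suc n))

  DownUpᶠ : ∀ n → Carrier → Fin (p r n) ⊸ Fin (p r n)
  DownUpᶠ n s = s ·ˡ idˡ +ˡ Downᶠ n ∘ˡ Upᶠ n

  Up-entries : ∀ n i j → entries (Upᶠ n) i j ≈ ind (word r n j ⋖? word r (suc n) i)
  Up-entries n i j = trans (up-cong (suc n) (basis-enumerate n j) (E.to (suc n) i))
    (trans (up-basis (suc n) (E.to n j) (E.to (suc n) i))
      (reflexive (≡.cong₂ (λ v w → ind (v ⋖? w)) (toWord-enumerate r n j) (toWord-enumerate r (suc n) i))))

  Down-entries : ∀ n i j → entries (Downᶠ n) i j ≈ ind (word r n i ⋖? word r (suc n) j)
  Down-entries n i j = trans (down-cong (suc n) (basis-enumerate (suc n) j) (E.to n i))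
    (trans (down-basis (suc n) (E.to (suc n) j) (E.to n i))
      (reflexive (≡.cong₂ (λ v w → ind (v ⋖? w)) (toWord-enumerate r n i) (toWord-enumerate r (suc n) j))))

  DownUpᶠ-~ : ∀ n s → DownUpᶠ n s ~ DownUp (suc n) s
  DownUpᶠ-~ n s = ~-reindex (↔-sym (enumerate r n)) λ y i → +-congˡ
    (down-cong (suc n) (λ w → trans (reflexive (≡.cong (up (suc n) _) (E.strictlyInverseˡ (suc n) w)))
       (up-cong (suc n) (λ v → reflexive (≡.cong y (E.strictlyInverseˡ n v))) w)) (E.to n i))

-- Smith forms over ℤ[t].

module _ where

  open CommutativeRing ℤ[t] hiding (zero)
  open SemiringSum semiring using (sum; sum-cong-≋)
  open SemiringSum (CommutativeRing.semiring ℤ.+-*-commutativeRing) using () renaming (sum to sumℤ)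
  open Matℤ[t]
  open MatrixForm ℤ[t]
  open Equivalence ℤ[t]

  const-0 : const 0ℤ ≈ 0#
  const-0 = coeffwise λ { zero → ≡.refl ; (suc k) → ≡.refl }

  const-* : ∀ a b → const (a ℤ.* b) ≈ const a * const b
  const-* a b = coeffwise λ { zero → ≡.sym (ℤ.+-identityʳ _) ; (suc k) → ≡.refl }

  const-sum : ∀ {n} (x : Vector ℤ n) → const (sumℤ x) ≈ sum (λ i → const (x i))
  const-sum {zero}  x = const-0
  const-sum {suc n} x = +-congˡ {const (x zero)} {const (sumℤ (x ∘ suc))} (const-sum (x ∘ suc))

  const-ind : ∀ b → const (if b then 1ℤ else 0ℤ) ≈ (if b then 1# else 0#)
  const-ind true  = refl
  const-ind false = const-0

  -- `const` respects sums, products and the entries 0 and 1, so it carries the integer product D U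
  -- to the product of the same matrices over ℤ[t].
  DU+tI-entries : ∀ r n → DU+tI r n ≈ᴹ entries (UpDownMatrices.DownUpᶠ ℤ[t] r n t)
  DU+tI-entries r n i j = trans (+-comm (const (DU r n i j)) (t * 1ᴹ i j)) (+-congˡ {t * 1ᴹ i j}
    (trans (const-sum (λ k → D r n i k ℤ.* U r n k j)) (trans (sum-cong-≋ (λ k → trans (const-* (D r n i k) (U r n k j))
      (*-cong (trans (const-ind _) (sym (Down-entries n i k))) (trans (const-ind _) (sym (Up-entries n k j))))))
    (entries-∘ (Downᶠ n) (Upᶠ n) i j))))
    where open UpDownMatrices ℤ[t] r

  DU+tI-hasSmithForm : ∀ r → 1 ℕ.≤ r → ∀ n → HasSmithForm (DU+tI r n)
  DU+tI-hasSmithForm r 1≤r n = hasSmithForm (DownUpᶠ n t) (DU+tI-entries r n)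
    (smith-resp-~ (DownUpᶠ-~ n t) (DownUp-smith ℤ[t] r 1≤r n t))
    where open UpDownMatrices ℤ[t] r

-- Freeness of the cokernel.

module _ {m n k} (A : Matℤ.Matrix m n) (θ : (Fin n ⊎ Fin k) ↔ Fin m) where

  open Matℤ using (_*ᵛ_)
  open ≡.≡-Reasoning

  private
    module θ = Inverse θ
    module A = GroupMorphisms.IsGroupHomomorphism (Matℤ.*ᵛ-isGroupHomomorphism A)

    pad : Vector ℤ k → Fin n ⊎ Fin k → ℤ
    pad y = [ (λ _ → 0ℤ) , y ]

    pad-cong : ∀ {x y} → (∀ l → x l ≡ y l) → ∀ c → pad x c ≡ pad y c
    pad-cong eq = [ (λ _ → ≡.refl) , eq ]

    pad-θ : ∀ y c → pad y (θ.from (θ.to c)) ≡ pad y c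
    pad-θ y c = ≡.cong (pad y) (θ.strictlyInverseʳ c)

    coker-reflexive : ∀ {x y} → (∀ i → x i ≡ y i) → AbelianGroup._≈_ (coker A) x y
    coker-reflexive {y = y} eq = (λ _ → 0ℤ) , λ i →
      ≡.trans (≡.cong (ℤ._- y i) (eq i)) (≡.trans (ℤ.+-inverseʳ (y i)) (≡.sym (A.ε-homo i)))

  -- As A is the identity on the first block, each class has exactly one representative that
  -- vanishes there; its second block gives free coordinates.
  coker-free : (∀ x j → (A *ᵛ x) (θ.to (inj₁ j)) ≡ x j) → IsFree (coker A)
  coker-free top = k , (λ y → pad y ∘ θ.from) , record
    { isGroupMonomorphism = record
      { isGroupHomomorphism = record
        { isMonoidHomomorphism = record
          { isMagmaHomomorphism = record
            { isRelHomomorphism = record { cong = λ eq → coker-reflexive (λ i → pad-cong eq (θ.from i)) }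
            ; homo = λ x y → coker-reflexive λ i →
                [_,_] {C = λ c → pad (λ l → x l ℤ.+ y l) c ≡ pad x c ℤ.+ pad y c} (λ _ → ≡.refl) (λ _ → ≡.refl) (θ.from i)
            }
          ; ε-homo = coker-reflexive λ i →
              [_,_] {C = λ c → pad (λ _ → 0ℤ) c ≡ 0ℤ} (λ _ → ≡.refl) (λ _ → ≡.refl) (θ.from i)
          }
        ; ⁻¹-homo = λ x → coker-reflexive λ i →
            [_,_] {C = λ c → pad (λ l → ℤ.- x l) c ≡ ℤ.- pad x c} (λ _ → ≡.refl) (λ _ → ≡.refl) (θ.from i)
        }
      ; injective = injective
      }
    ; surjective = surjective
    }
    where
    injective : ∀ {y y′} → AbelianGroup._≈_ (coker A) (pad y ∘ θ.from) (pad y′ ∘ θ.from) → ∀ l → y l ≡ y′ l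
    injective {y} {y′} (x , eq) l = ℤ.i-j≡0⇒i≡j (y l) (y′ l) (begin
      y l ℤ.- y′ l             ≡⟨ difference (inj₂ l) ⟩
      (A *ᵛ x) (θ.to (inj₂ l)) ≡⟨ A.⟦⟧-cong x≡0 (θ.to (inj₂ l)) ⟩
      (A *ᵛ (λ _ → 0ℤ)) (θ.to (inj₂ l)) ≡⟨ A.ε-homo (θ.to (inj₂ l)) ⟩
      0ℤ                       ∎)
      where
      difference : ∀ c → pad y c ℤ.- pad y′ c ≡ (A *ᵛ x) (θ.to c)
      difference c = ≡.trans (≡.sym (≡.cong₂ ℤ._-_ (pad-θ y c) (pad-θ y′ c))) (eq (θ.to c))

      -- Both padded vectors vanish on the first block, where A x is x.
      x≡0 : ∀ j → x j ≡ 0ℤ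
      x≡0 j = ≡.trans (≡.sym (top x j)) (≡.sym (difference (inj₁ j)))

    surjective : ∀ v → ∃[ y ] (∀ {z} → (∀ l → z l ≡ y l) → AbelianGroup._≈_ (coker A) (pad z ∘ θ.from) v)
    -- With x the first block of v, the vector v - A x vanishes on the first block and differs from
    -- v by A (-x).
    surjective v = (λ l → v (θ.to (inj₂ l)) ℤ.- (A *ᵛ x) (θ.to (inj₂ l))) , λ {z} z≡ →
      ((λ j → ℤ.- x j) , λ i → ≡.subst (λ i → pad z (θ.from i) ℤ.- v i ≡ (A *ᵛ (λ j → ℤ.- x j)) i) (θ.strictlyInverseˡ i)
        (≡.trans (≡.cong (ℤ._- v (θ.to (θ.from i))) (pad-θ z (θ.from i))) (difference z z≡ (θ.from i))))
      where
      x : Vector ℤ n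
      x j = v (θ.to (inj₁ j))

      cancel : ∀ a b → (a ℤ.- b) ℤ.- a ≡ ℤ.- b
      cancel = solve-∀

      difference : ∀ z → (∀ l → z l ≡ v (θ.to (inj₂ l)) ℤ.- (A *ᵛ x) (θ.to (inj₂ l))) →
        ∀ c → pad z c ℤ.- v (θ.to c) ≡ (A *ᵛ (λ j → ℤ.- x j)) (θ.to c)
      difference z z≡ (inj₁ j) = ≡.trans (ℤ.+-identityˡ _) (≡.sym (top (λ j → ℤ.- x j) j))
      difference z z≡ (inj₂ l) = ≡.trans (≡.cong (ℤ._- v (θ.to (inj₂ l))) (z≡ l))
        (≡.trans (cancel (v (θ.to (inj₂ l))) _) (≡.sym (A.⁻¹-homo x (θ.to (inj₂ l)))))

module _ (r n : ℕ) where

  open MatrixForm ℤ.+-*-commutativeRing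
  open SemiringSum (CommutativeRing.semiring ℤ.+-*-commutativeRing) using (sum-cong-≋)
  open UpDown ℤ.+-*-commutativeRing r
  open UpDownMatrices ℤ.+-*-commutativeRing r

  U-free : ∀ {J} → Finite J → (θ : (Idx r (suc n) ⊎ J) ↔ Idx r (suc (suc n))) →
    (∀ x w → up (suc n) x (Inverse.to θ (inj₁ w)) ≡ x w) → IsFree (coker (U r n))
  U-free (k , η) θ up-θ = coker-free (U r n)
    (↔-trans (enumerate r n ⊎-↔ ↔-sym η) (↔-trans θ (↔-sym (enumerate r (suc n))))) λ x j → begin
      (U r n Matℤ.*ᵛ x) (E.from (suc n) (θ.to (inj₁ (E.to n j))))
        ≡⟨ sum-cong-≋ (λ l → ≡.cong (ℤ._* x l) (Up-entries n (E.from (suc n) (θ.to (inj₁ (E.to n j)))) l)) ⟨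
      _ ≡⟨ ap-entries (Upᶠ n) x (E.from (suc n) (θ.to (inj₁ (E.to n j)))) ⟨
      up (suc n) (x ∘ E.from n) (E.to (suc n) (E.from (suc n) (θ.to (inj₁ (E.to n j)))))
        ≡⟨ ≡.cong (up (suc n) (x ∘ E.from n)) (E.strictlyInverseˡ (suc n) _) ⟩
      up (suc n) (x ∘ E.from n) (θ.to (inj₁ (E.to n j)))
        ≡⟨ up-θ (x ∘ E.from n) (E.to n j) ⟩
      x (E.from n (E.to n j))
        ≡⟨ ≡.cong x (E.strictlyInverseʳ n j) ⟩
      x j ∎
    where
    open ≡.≡-Reasoning
    module θ = Inverse θ
    module E n = Inverse (enumerate r n)

coker-U-free : ∀ r → 1 ℕ.≤ r → ∀ n → IsFree (coker (U r n))
coker-U-free (suc zero)      _ n = U-free 1 n (Idx-finite 1 n) (split₁ n) (λ x w → ≡.refl)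
coker-U-free r@(suc (suc m)) _ n = U-free r n (⊎-finite (Idx-finite r (suc n)) (Rest-finite r m n)) (split₂ m n) (λ x w → ≡.refl)

-- Growth of the rank sizes.

-- q counts the words of rank n + 1 that do not begin with the first letter of value 1. For r = 1
-- they begin with 2 and number p_{n-1}; for r ≥ 2 the second letter of value 1 alone gives p_n of
-- them.
p-suc : ∀ r → 1 ℕ.≤ r → ∀ n → ∃[ q ] p r (suc n) ≡ p r n ℕ.+ q × pℤ r (+ n ℤ.- δ r 1) ℤ.≤ + q
p-suc (suc zero) _ n = proj₁ (Idx-finite 1 n)
  , ↔⇒≡ (↔-trans (enumerate 1 (suc n)) (↔-trans (↔-sym (split₁ n)) (proj₂ (⊎-finite (Idx-finite 1 (suc n)) (Idx-finite 1 n)))))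
  , ℤ.≤-reflexive (p-pred n)
  where
  p-pred : ∀ n → pℤ 1 (+ n ℤ.- 1ℤ) ≡ + proj₁ (Idx-finite 1 n)
  p-pred zero    = ≡.refl
  p-pred (suc n) = ≡.refl
p-suc r@(suc (suc m)) _ n = p r n ℕ.+ proj₁ (Rest-finite r m n)
  , ↔⇒≡ (↔-trans (enumerate r (suc n)) (↔-trans (↔-sym (split₂ m n))
      (proj₂ (⊎-finite (Idx-finite r (suc n)) (⊎-finite (Idx-finite r (suc n)) (Rest-finite r m n))))))
  , ≡.subst (λ i → pℤ r i ℤ.≤ + (p r n ℕ.+ proj₁ (Rest-finite r m n))) (≡.sym (ℤ.+-identityʳ (+ n)))
      (ℤ.+≤+ (ℕ.m≤m+n (p r n) _))

module _ (r : ℕ) (1≤r : 1 ℕ.≤ r) where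

  p-≤-suc : ∀ n → p r n ℕ.≤ p r (suc n)
  p-≤-suc n with q , eq , _ ← p-suc r 1≤r n = ≡.subst (p r n ℕ.≤_) (≡.sym eq) (ℕ.m≤m+n (p r n) q)

  p-mono : ∀ {m n} → m ℕ.≤′ n → p r m ℕ.≤ p r n
  p-mono (ℕ.≤′-reflexive ≡.refl) = ℕ.≤-refl
  p-mono (ℕ.≤′-step {n} m≤n)     = ℕ.≤-trans (p-mono m≤n) (p-≤-suc n)

  pℤ-nonneg : ∀ i → 0ℤ ℤ.≤ pℤ r i
  pℤ-nonneg (+ n)    = ℤ.+≤+ ℕ.z≤n
  pℤ-nonneg -[1+ n ] = ℤ.≤-refl

  pℤ-mono : ∀ {i j} → i ℤ.≤ j → pℤ r i ℤ.≤ pℤ r j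
  pℤ-mono {j = j} (ℤ.-≤- _)  = ℤ.≤-refl
  pℤ-mono {j = j} ℤ.-≤+      = pℤ-nonneg j
  pℤ-mono (ℤ.+≤+ m≤n)        = ℤ.+≤+ (p-mono (ℕ.≤⇒≤′ m≤n))

  Δp≤pℤ : ∀ i → Δp r i ℤ.≤ pℤ r i
  Δp≤pℤ i = ℤ.≤-trans (ℤ.+-monoʳ-≤ (pℤ r i) (ℤ.neg-mono-≤ (pℤ-nonneg (i ℤ.- 1ℤ)))) (ℤ.≤-reflexive (ℤ.+-identityʳ _))

  pℤ≤Δp-suc : ∀ n → pℤ r (+ n ℤ.- δ r 1) ℤ.≤ Δp r (+ suc n)
  pℤ≤Δp-suc n with q , eq , le ← p-suc r 1≤r n = ℤ.≤-trans le (ℤ.≤-reflexive (≡.sym (begin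
    + p r (suc n) ℤ.- + p r n          ≡⟨ ≡.cong (λ x → + x ℤ.- + p r n) eq ⟩
    + p r n ℤ.+ + q ℤ.- + p r n        ≡⟨ cancel (+ p r n) (+ q) ⟩
    + q                                ∎)))
    where
    open ≡.≡-Reasoning
    cancel : ∀ a b → a ℤ.+ b ℤ.- a ≡ b
    cancel = solve-∀

  -- With δ for `δ r 1`, Δp_{n-j-δ} ≤ p_{n-j-δ} ≤ p_{n-1-δ} ≤ Δp_n. The middle step is monotonicity
  -- of p on all of ℤ, negative indices included.
  Δp-≥ : ∀ n j → 1 ℕ.≤ n → 1 ℕ.≤ j → Δp r (+ n) ℤ.≥ Δp r (+ n ℤ.- + j ℤ.- δ r 1)
  Δp-≥ (suc n) j _ 1≤j = ℤ.≤-trans (Δp≤pℤ (+ suc n ℤ.- + j ℤ.- δ r 1)) (ℤ.≤-trans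
    (pℤ-mono (ℤ.+-monoˡ-≤ (ℤ.- δ r 1) (ℤ.+-monoʳ-≤ (+ suc n) (ℤ.neg-mono-≤ (ℤ.+≤+ 1≤j)))))
    (pℤ≤Δp-suc n))

theorem5p1 : (r : ℕ) → 1 ≤ r →
    ((n : ℕ) → Matℤ[t].HasSmithForm (DU+tI r n))
    × ((n j : ℕ) → 1 ≤ n → 1 ≤ j → j ≤ n → Δp r (+ n) ℤ.≥ Δp r (+ n ℤ.- + j ℤ.- δ r 1))
    × ((n : ℕ) → IsFree (coker (U r n)))
theorem5p1 r 1≤r = DU+tI-hasSmithForm r 1≤r , (λ n j 1≤n 1≤j _ → Δp-≥ r 1≤r n j 1≤n 1≤j) , coker-U-free r 1≤r
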